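{- Let $q$ be a complex number with $|q|<1$, and for integers $m\ge0$ let $$U_m(x)=\sum_{k=0}^m\begin{bmatrix}m+k\\k\end{bmatrix}_q\frac{x^k}{(-q;q)_k}.$$ Then for every integer $m\ge 0$ and every $x$, $$(1-q^{m+2})U_{m+2}(x)+(xq^{2m+3}-q-1)U_{m+1}(x)+q(1+q^{m+1})U_{m}(x)=(x-q)\frac{(q^{m+2};q)_m}{(q^2;q^2)_m}x^{m+1}.$$
   Context: For integers $n\ge 0$, $(x;p)_n=\prod_{i=0}^{n-1}(1-xp^i)$ (empty product equal to $1$). The $q$-binomial coefficient is $\begin{bmatrix}n\\k\end{bmatrix}_q=\frac{(q;q)_n}{(q;q)_{n-k}(q;q)_k}$. -}

module Defs where

-- The real numbers are Cauchy sequences of rationals modulo the usual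
-- equivalence, and the complex numbers are pairs of reals.  Both are setoids:
-- _≈ᴿ_ and _≈_ play the role of equality.  Convergence proofs and the
-- operations on ℂ are opaque so that conversion checking does not unfold them.

open import Algebra.Bundles.Raw using (RawRing)
open import Data.Fin.Base using (Fin; zero; suc; toℕ)
open import Data.Integer.Base as ℤ using (+_; +[1+_]; -[1+_])
import Data.Integer.Properties as ℤ
open import Data.Nat.Base as ℕ using (ℕ; zero; suc)
import Data.Nat.Properties as ℕ
open import Data.Nat.Coprimality as Coprimality using (1-coprimeTo)
open import Data.Product.Base using (∃; _×_; _,_; proj₁; proj₂)
open import Data.Rational.Base as ℚ using (ℚ; 0ℚ; 1ℚ; ½; mkℚ)
import Data.Rational.Base
import Data.Rational.Properties as ℚ
open import Data.Rational.Solver using (module +-*-Solver)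
import Data.Rational.Unnormalised.Base as ℚᵘ
import Data.Rational.Unnormalised.Properties as ℚᵘ
open import Data.Sum.Base using (inj₁; inj₂)
open import Data.Vec.Functional using (Vector)
open import Level using (0ℓ)
open import Relation.Binary.PropositionalEquality
  using (_≡_; refl; sym; trans; cong; cong₂; subst; subst₂; module ≡-Reasoning)
open import Relation.Nullary using (yes; no; contradiction)

open +-*-Solver using (solve; _:+_; _:*_; _:-_; :-_; _:=_; con)

module _ where
  open Data.Rational.Base using (_+_; _*_; -_; _-_; _≤_; _<_; ∣_∣)

  -- Inequalities are proved by exhibiting the difference of the two sides as
  -- a visibly nonnegative (or positive) expression.

  ≤-by : ∀ {p q} e → 0ℚ ≤ e → p + e ≡ q → p ≤ q
  ≤-by {p} e 0≤e eq =
    subst (_≤ _) (ℚ.+-identityʳ p) (ℚ.≤-trans (ℚ.+-monoʳ-≤ p 0≤e) (ℚ.≤-reflexive eq))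

  <-by : ∀ {p q} e → 0ℚ < e → p + e ≡ q → p < q
  <-by {p} e 0<e eq =
    subst (_< _) (ℚ.+-identityʳ p) (ℚ.<-≤-trans (ℚ.+-monoʳ-< p 0<e) (ℚ.≤-reflexive eq))

  ≤⇒0≤ : ∀ {p q} → p ≤ q → 0ℚ ≤ q - p
  ≤⇒0≤ {p} {q} p≤q =
    subst (_≤ q - p) (ℚ.+-inverseʳ p) (ℚ.+-monoˡ-≤ (- p) p≤q)

  <⇒0< : ∀ {p q} → p < q → 0ℚ < q - p
  <⇒0< {p} {q} p<q =
    subst (_< q - p) (ℚ.+-inverseʳ p) (ℚ.+-monoˡ-< (- p) p<q)

  0≤+ : ∀ {p q} → 0ℚ ≤ p → 0ℚ ≤ q → 0ℚ ≤ p + q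
  0≤+ = ℚ.+-mono-≤

  0<+ : ∀ {p q} → 0ℚ < p → 0ℚ ≤ q → 0ℚ < p + q
  0<+ = ℚ.+-mono-<-≤

  0≤* : ∀ {p q} → 0ℚ ≤ p → 0ℚ ≤ q → 0ℚ ≤ p * q
  0≤* {p} {q} 0≤p 0≤q = subst (_≤ p * q) (ℚ.*-zeroʳ p)
    (ℚ.*-monoˡ-≤-nonNeg p {{ℚ.nonNegative 0≤p}} 0≤q)

  0<* : ∀ {p q} → 0ℚ < p → 0ℚ < q → 0ℚ < p * q
  0<* {p} {q} 0<p 0<q = subst (_< p * q) (ℚ.*-zeroʳ p)
    (ℚ.*-monoʳ-<-pos p {{ℚ.positive 0<p}} 0<q)

  0≤sq : ∀ p → 0ℚ ≤ p * p
  0≤sq p with ℚ.≤-total 0ℚ p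
  ... | inj₁ 0≤p = 0≤* 0≤p 0≤p
  ... | inj₂ p≤0 = subst (0ℚ ≤_) (solve 1 (λ p → (:- p) :* (:- p) := p :* p) refl p)
                     (0≤* 0≤-p 0≤-p)
    where 0≤-p = ℚ.neg-antimono-≤ p≤0

  0<1 : 0ℚ < 1ℚ
  0<1 = ℚ.positive⁻¹ 1ℚ

  0<½ : 0ℚ < ½
  0<½ = ℚ.positive⁻¹ ½

  half+half : ∀ p → p * ½ + p * ½ ≡ p
  half+half = solve 1 (λ p → p :* con ½ :+ p :* con ½ := p) refl

  0<half : ∀ {p} → 0ℚ < p → 0ℚ < p * ½
  0<half 0<p = 0<* 0<p 0<½

  ∣∣<-intro : ∀ {p ε} → p < ε → - p < ε → ∣ p ∣ < ε
  ∣∣<-intro {p} p<ε -p<ε with ℚ.∣p∣≡p∨∣p∣≡-p p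
  ... | inj₁ eq = subst (_< _) (sym eq) p<ε
  ... | inj₂ eq = subst (_< _) (sym eq) -p<ε

  p≤∣p∣ : ∀ p → p ≤ ∣ p ∣
  p≤∣p∣ p with ℚ.≤-total 0ℚ p
  ... | inj₁ 0≤p = ℚ.≤-reflexive (sym (ℚ.0≤p⇒∣p∣≡p 0≤p))
  ... | inj₂ p≤0 = ℚ.≤-trans p≤0 (ℚ.0≤∣p∣ p)

  -- Total reciprocal, with the junk value recip 0 = 0.
  recip : ℚ → ℚ
  recip p@(mkℚ (+ 0)    _ _) = 0ℚ
  recip p@(mkℚ +[1+ _ ] _ _) = ℚ.1/ p
  recip p@(mkℚ -[1+ _ ] _ _) = ℚ.1/ p

  recip-inverseʳ : ∀ {p} → 0ℚ < p → p * recip p ≡ 1ℚ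
  recip-inverseʳ {mkℚ (+ 0) _ _} 0<p with ℚ.positive 0<p
  ... | ()
  recip-inverseʳ {p@(mkℚ +[1+ _ ] _ _)} 0<p = ℚ.*-inverseʳ p
  recip-inverseʳ {p@(mkℚ -[1+ _ ] _ _)} 0<p = ℚ.*-inverseʳ p

  0<recip : ∀ {p} → 0ℚ < p → 0ℚ < recip p
  0<recip {mkℚ (+ 0) _ _} 0<p with ℚ.positive 0<p
  ... | ()
  0<recip {p@(mkℚ +[1+ _ ] _ _)} 0<p = ℚ.positive⁻¹ _ {{ℚ.1/pos⇒pos p}}
  0<recip {mkℚ -[1+ _ ] _ _} 0<p with ℚ.positive 0<p
  ... | ()

  1/1+ : ℕ → ℚ
  1/1+ n = mkℚ (+ 1) n (1-coprimeTo (suc n))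

  0<1/1+ : ∀ n → 0ℚ < 1/1+ n
  0<1/1+ n = ℚ.positive⁻¹ (1/1+ n)

  archimedean : ∀ {ε} → 0ℚ < ε → ∃ λ N → ∀ n → N ℕ.≤ n → 1/1+ n ≤ ε
  archimedean {mkℚ (+ 0) _ _} 0<ε with ℚ.positive 0<ε
  ... | ()
  archimedean {mkℚ -[1+ _ ] _ _} 0<ε with ℚ.positive 0<ε
  ... | ()
  archimedean {mkℚ +[1+ a ] d _} _ = d , λ n d≤n → ℚ.*≤* (ℤ.+≤+ (begin
      1 ℕ.* suc d      ≡⟨ ℕ.*-identityˡ (suc d) ⟩
      suc d            ≤⟨ ℕ.s≤s d≤n ⟩
      suc n            ≤⟨ ℕ.m≤m+n (suc n) (a ℕ.* suc n) ⟩
      suc a ℕ.* suc n  ∎))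
    where open ℕ.≤-Reasoning

module _ where
  open Data.Rational.Base using (_-_; _<_; ∣_∣)

  IsCauchy : (ℕ → ℚ) → Set
  IsCauchy s = ∀ ε → 0ℚ < ε →
    ∃ λ N → ∀ m n → N ℕ.≤ m → N ℕ.≤ n → ∣ s m - s n ∣ < ε

record ℝ : Set where
  no-eta-equality
  constructor mkℝ
  field
    seq      : ℕ → ℚ
    isCauchy : IsCauchy seq

open ℝ public

module _ where
  open Data.Rational.Base using (_+_; _*_; -_; _-_; _≤_; _<_; ∣_∣)

  opaque
    const-isCauchy : ∀ p → IsCauchy (λ _ → p)
    const-isCauchy p ε 0<ε = 0 , λ _ _ _ _ →
      subst (λ d → ∣ d ∣ < ε) (sym (ℚ.+-inverseʳ p)) 0<ε

    +-isCauchy : ∀ s t → IsCauchy s → IsCauchy t → IsCauchy (λ n → s n + t n)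
    +-isCauchy s t cs ct ε 0<ε =
      let (M , hs) = cs (ε * ½) (0<half 0<ε)
          (N , ht) = ct (ε * ½) (0<half 0<ε)
      in M ℕ.⊔ N , λ m n m≥ n≥ → begin-strict
        ∣ (s m + t m) - (s n + t n) ∣
          ≡⟨ cong ∣_∣ (solve 4 (λ a b c d → (a :+ b) :- (c :+ d) := (a :- c) :+ (b :- d)) refl
                         (s m) (t m) (s n) (t n)) ⟩
        ∣ (s m - s n) + (t m - t n) ∣
          ≤⟨ ℚ.∣p+q∣≤∣p∣+∣q∣ (s m - s n) (t m - t n) ⟩
        ∣ s m - s n ∣ + ∣ t m - t n ∣
          <⟨ ℚ.+-mono-< (hs m n (ℕ.m⊔n≤o⇒m≤o M N m≥) (ℕ.m⊔n≤o⇒m≤o M N n≥))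
                        (ht m n (ℕ.m⊔n≤o⇒n≤o M N m≥) (ℕ.m⊔n≤o⇒n≤o M N n≥)) ⟩
        ε * ½ + ε * ½
          ≡⟨ half+half ε ⟩
        ε ∎
      where open ℚ.≤-Reasoning

    neg-isCauchy : ∀ s → IsCauchy s → IsCauchy (λ n → - s n)
    neg-isCauchy s cs ε 0<ε = let (N , h) = cs ε 0<ε in N , λ m n m≥ n≥ → subst (_< ε)
      (trans (sym (ℚ.∣-p∣≡∣p∣ (s m - s n)))
             (cong ∣_∣ (solve 2 (λ a b → :- (a :- b) := (:- a) :- (:- b)) refl (s m) (s n))))
      (h m n m≥ n≥)

  eventually-bounded : ∀ s → IsCauchy s →
    ∃ λ B → 0ℚ < B × ∃ λ N → ∀ n → N ℕ.≤ n → ∣ s n ∣ ≤ B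
  eventually-bounded s cs = let (N , h) = cs 1ℚ 0<1 in
    1ℚ + ∣ s N ∣ , 0<+ 0<1 (ℚ.0≤∣p∣ (s N)) , N , λ n n≥ → begin
      ∣ s n ∣                  ≡⟨ cong ∣_∣ (solve 2 (λ a b → a := (a :- b) :+ b) refl (s n) (s N)) ⟩
      ∣ (s n - s N) + s N ∣    ≤⟨ ℚ.∣p+q∣≤∣p∣+∣q∣ (s n - s N) (s N) ⟩
      ∣ s n - s N ∣ + ∣ s N ∣  ≤⟨ ℚ.+-monoˡ-≤ ∣ s N ∣ (ℚ.<⇒≤ (h n N n≥ ℕ.≤-refl)) ⟩
      1ℚ + ∣ s N ∣             ∎
    where open ℚ.≤-Reasoning

  *-close : ∀ {a b a′ b′ B C δ η} → ∣ a ∣ ≤ B → ∣ b′ ∣ ≤ C → 0ℚ < B → 0ℚ < C →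
            ∣ b - b′ ∣ < δ → ∣ a - a′ ∣ < η → ∣ a * b - a′ * b′ ∣ < B * δ + η * C
  *-close {a} {b} {a′} {b′} {B} {C} {δ} {η} a≤B b′≤C 0<B 0<C b~b′ a~a′ = begin-strict
      ∣ a * b - a′ * b′ ∣
        ≡⟨ cong ∣_∣ (solve 4 (λ a b a′ b′ → a :* b :- a′ :* b′
                                := a :* (b :- b′) :+ (a :- a′) :* b′) refl a b a′ b′) ⟩
      ∣ a * (b - b′) + (a - a′) * b′ ∣
        ≤⟨ ℚ.∣p+q∣≤∣p∣+∣q∣ (a * (b - b′)) ((a - a′) * b′) ⟩
      ∣ a * (b - b′) ∣ + ∣ (a - a′) * b′ ∣
        ≡⟨ cong₂ _+_ (ℚ.∣p*q∣≡∣p∣*∣q∣ a (b - b′)) (ℚ.∣p*q∣≡∣p∣*∣q∣ (a - a′) b′) ⟩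
      ∣ a ∣ * ∣ b - b′ ∣ + ∣ a - a′ ∣ * ∣ b′ ∣
        ≤⟨ ℚ.+-mono-≤ (ℚ.*-monoʳ-≤-nonNeg ∣ b - b′ ∣ {{ℚ.∣-∣-nonNeg (b - b′)}} a≤B)
                      (ℚ.*-monoˡ-≤-nonNeg ∣ a - a′ ∣ {{ℚ.∣-∣-nonNeg (a - a′)}} b′≤C) ⟩
      B * ∣ b - b′ ∣ + ∣ a - a′ ∣ * C
        <⟨ ℚ.+-mono-< (ℚ.*-monoʳ-<-pos B {{ℚ.positive 0<B}} b~b′)
                      (ℚ.*-monoˡ-<-pos C {{ℚ.positive 0<C}} a~a′) ⟩
      B * δ + η * C ∎
    where open ℚ.≤-Reasoning

  opaque
    *-isCauchy : ∀ s t → IsCauchy s → IsCauchy t → IsCauchy (λ n → s n * t n)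
    *-isCauchy s t cs ct ε 0<ε =
      let (B , 0<B , K , s≤B) = eventually-bounded s cs
          (C , 0<C , L , t≤C) = eventually-bounded t ct
          (M , ht) = ct (recip B * (ε * ½)) (0<* (0<recip 0<B) (0<half 0<ε))
          (N , hs) = cs (ε * ½ * recip C) (0<* (0<half 0<ε) (0<recip 0<C))
      in (K ℕ.⊔ L) ℕ.⊔ (M ℕ.⊔ N) , λ m n m≥ n≥ →
        let m≥K⊔L = ℕ.m⊔n≤o⇒m≤o (K ℕ.⊔ L) (M ℕ.⊔ N) m≥
            n≥K⊔L = ℕ.m⊔n≤o⇒m≤o (K ℕ.⊔ L) (M ℕ.⊔ N) n≥
            m≥M⊔N = ℕ.m⊔n≤o⇒n≤o (K ℕ.⊔ L) (M ℕ.⊔ N) m≥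
            n≥M⊔N = ℕ.m⊔n≤o⇒n≤o (K ℕ.⊔ L) (M ℕ.⊔ N) n≥
        in subst (∣ s m * t m - s n * t n ∣ <_) (modulus 0<B 0<C)
             (*-close {s m} {t m} {s n} {t n} {B} {C} {recip B * (ε * ½)} {ε * ½ * recip C}
               (s≤B m (ℕ.m⊔n≤o⇒m≤o K L m≥K⊔L)) (t≤C n (ℕ.m⊔n≤o⇒n≤o K L n≥K⊔L))
               0<B 0<C
               (ht m n (ℕ.m⊔n≤o⇒m≤o M N m≥M⊔N) (ℕ.m⊔n≤o⇒m≤o M N n≥M⊔N))
               (hs m n (ℕ.m⊔n≤o⇒n≤o M N m≥M⊔N) (ℕ.m⊔n≤o⇒n≤o M N n≥M⊔N)))
      where
      open ≡-Reasoning
      modulus : ∀ {B C} → 0ℚ < B → 0ℚ < C →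
                B * (recip B * (ε * ½)) + ε * ½ * recip C * C ≡ ε
      modulus {B} {C} 0<B 0<C = begin
        B * (recip B * (ε * ½)) + ε * ½ * recip C * C
          ≡⟨ solve 5 (λ b b⁻¹ h c⁻¹ c → b :* (b⁻¹ :* h) :+ h :* c⁻¹ :* c
                        := (b :* b⁻¹) :* h :+ h :* (c :* c⁻¹)) refl B (recip B) (ε * ½) (recip C) C ⟩
        (B * recip B) * (ε * ½) + ε * ½ * (C * recip C)
          ≡⟨ cong₂ (λ u v → u * (ε * ½) + ε * ½ * v) (recip-inverseʳ 0<B) (recip-inverseʳ 0<C) ⟩
        1ℚ * (ε * ½) + ε * ½ * 1ℚ
          ≡⟨ cong₂ _+_ (ℚ.*-identityˡ (ε * ½)) (ℚ.*-identityʳ (ε * ½)) ⟩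
        ε * ½ + ε * ½
          ≡⟨ half+half ε ⟩
        ε ∎

  infix 4 _≈ᴿ_ _<ᴿ_

  _≈ᴿ_ : ℝ → ℝ → Set
  x ≈ᴿ y = ∀ ε → 0ℚ < ε → ∃ λ N → ∀ n → N ℕ.≤ n → ∣ seq x n - seq y n ∣ < ε

  _<ᴿ_ : ℝ → ℝ → Set
  x <ᴿ y = ∃ λ ε → 0ℚ < ε × ∃ λ N → ∀ n → N ℕ.≤ n → seq x n + ε ≤ seq y n

  infixl 6 _+ᴿ_
  infixl 7 _*ᴿ_
  infix  8 -ᴿ_

  0ᴿ 1ᴿ : ℝ
  0ᴿ = mkℝ (λ _ → 0ℚ) (const-isCauchy 0ℚ)
  1ᴿ = mkℝ (λ _ → 1ℚ) (const-isCauchy 1ℚ)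

  _+ᴿ_ _*ᴿ_ : ℝ → ℝ → ℝ
  x +ᴿ y = mkℝ (λ n → seq x n + seq y n) (+-isCauchy (seq x) (seq y) (isCauchy x) (isCauchy y))
  x *ᴿ y = mkℝ (λ n → seq x n * seq y n) (*-isCauchy (seq x) (seq y) (isCauchy x) (isCauchy y))

  -ᴿ_ : ℝ → ℝ
  -ᴿ x = mkℝ (λ n → - seq x n) (neg-isCauchy (seq x) (isCauchy x))

  recip-close : ∀ {a b ε η} → 0ℚ < ε → 0ℚ < η → ε ≤ a → ε ≤ b →
                a - b < η * (ε * ε) → recip b - recip a < η
  recip-close {a} {b} {ε} {η} 0<ε 0<η ε≤a ε≤b a-b< =
    ℚ.*-cancelʳ-<-nonNeg (a * b) {{ℚ.nonNegative (0≤* (ℚ.<⇒≤ 0<a) (ℚ.<⇒≤ 0<b))}}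
      (begin-strict
        (recip b - recip a) * (a * b)
          ≡⟨ solve 4 (λ a b a⁻¹ b⁻¹ → (b⁻¹ :- a⁻¹) :* (a :* b)
                        := a :* (b :* b⁻¹) :- b :* (a :* a⁻¹)) refl a b (recip a) (recip b) ⟩
        a * (b * recip b) - b * (a * recip a)
          ≡⟨ cong₂ (λ u v → a * u - b * v) (recip-inverseʳ 0<b) (recip-inverseʳ 0<a) ⟩
        a * 1ℚ - b * 1ℚ
          ≡⟨ cong₂ _-_ (ℚ.*-identityʳ a) (ℚ.*-identityʳ b) ⟩
        a - b
          <⟨ a-b< ⟩
        η * (ε * ε)
          ≤⟨ ≤-by (η * (ε * (b - ε) + b * (a - ε)))
               (0≤* (ℚ.<⇒≤ 0<η) (0≤+ (0≤* (ℚ.<⇒≤ 0<ε) (≤⇒0≤ ε≤b)) (0≤* (ℚ.<⇒≤ 0<b) (≤⇒0≤ ε≤a))))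
               (solve 4 (λ a b ε η → η :* (ε :* ε) :+ η :* (ε :* (b :- ε) :+ b :* (a :- ε))
                           := η :* (a :* b)) refl a b ε η) ⟩
        η * (a * b) ∎)
    where
    open ℚ.≤-Reasoning
    0<a = ℚ.<-≤-trans 0<ε ε≤a
    0<b = ℚ.<-≤-trans 0<ε ε≤b

  opaque
    recip-isCauchy : ∀ (x : ℝ) → 0ᴿ <ᴿ x → IsCauchy (λ n → recip (seq x n))
    recip-isCauchy x (ε , 0<ε , M , x≥ε) η 0<η =
      let (N , h) = isCauchy x (η * (ε * ε)) (0<* 0<η (0<* 0<ε 0<ε))
          ε≤ : ∀ k → M ℕ.⊔ N ℕ.≤ k → ε ≤ seq x k
          ε≤ k k≥ = subst (_≤ seq x k) (ℚ.+-identityˡ ε) (x≥ε k (ℕ.m⊔n≤o⇒m≤o M N k≥))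
          close : ∀ j k → M ℕ.⊔ N ℕ.≤ j → M ℕ.⊔ N ℕ.≤ k → recip (seq x k) - recip (seq x j) < η
          close j k j≥ k≥ = recip-close 0<ε 0<η (ε≤ j j≥) (ε≤ k k≥)
            (ℚ.≤-<-trans (p≤∣p∣ (seq x j - seq x k))
              (h j k (ℕ.m⊔n≤o⇒n≤o M N j≥) (ℕ.m⊔n≤o⇒n≤o M N k≥)))
      in M ℕ.⊔ N , λ m n m≥ n≥ → ∣∣<-intro (close n m n≥ m≥)
           (subst (_< η) (solve 2 (λ a b → a :- b := :- (b :- a)) refl
                            (recip (seq x n)) (recip (seq x m)))
             (close m n m≥ n≥))

  recipᴿ : ∀ x → 0ᴿ <ᴿ x → ℝ
  recipᴿ x 0<x = mkℝ (λ n → recip (seq x n)) (recip-isCauchy x 0<x)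

module _ where
  open Data.Rational.Base using (_+_; _*_; -_; _-_; _≤_; _<_; ∣_∣)

  -- r approximates the square root of s from below with error less than δ.
  IsRoot : ℚ → ℚ → ℚ → Set
  IsRoot s δ r = 0ℚ ≤ r × r * r ≤ s × s < (r + δ) * (r + δ)

  infixl 7 _·_
  _·_ : ℕ → ℚ → ℚ
  zero  · δ = 0ℚ
  suc k · δ = δ + k · δ

  root-search : ∀ s δ k r → 0ℚ ≤ δ → 0ℚ ≤ r → r * r ≤ s →
                s < (r + k · δ) * (r + k · δ) → ∃ (IsRoot s δ)
  root-search s δ zero r 0≤δ 0≤r r²≤s s< =
    contradiction (subst (λ t → s < t * t) (ℚ.+-identityʳ r) s<) λ s<r² →
      ℚ.<-irrefl refl (ℚ.<-≤-trans s<r² r²≤s)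
  root-search s δ (suc k) r 0≤δ 0≤r r²≤s s< with (r + δ) * (r + δ) ℚ.≤? s
  ... | yes next≤s = root-search s δ k (r + δ) 0≤δ (0≤+ 0≤r 0≤δ) next≤s
                       (subst (λ t → s < t * t) (sym (ℚ.+-assoc r δ (k · δ))) s<)
  ... | no  next≰s = r , 0≤r , r²≤s , ℚ.≰⇒> next≰s

  ·-nonNeg : ∀ k {δ} → 0ℚ ≤ δ → 0ℚ ≤ k · δ
  ·-nonNeg zero    0≤δ = ℚ.≤-refl
  ·-nonNeg (suc k) 0≤δ = 0≤+ 0≤δ (·-nonNeg k 0≤δ)

  ·-*ʳ : ∀ k δ e → (k · δ) * e ≡ k · (δ * e)
  ·-*ʳ zero    δ e = ℚ.*-zeroˡ e
  ·-*ʳ (suc k) δ e = trans (ℚ.*-distribʳ-+ e δ (k · δ)) (cong (λ t → δ * e + t) (·-*ʳ k δ e))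

  fromℕ : ℕ → ℚ
  fromℕ k = mkℚ (+ k) 0 (Coprimality.sym (1-coprimeTo k))

  ·-1 : ∀ k → k · 1ℚ ≡ fromℕ k
  ·-1 zero    = ℚ.mkℚ-cong refl refl
  ·-1 (suc k) = trans (cong (λ t → 1ℚ + t) (·-1 k)) (ℚ.toℚᵘ-injective
    (ℚᵘ.≃-trans (ℚ.toℚᵘ-homo-+ 1ℚ (fromℕ k))
      (ℚᵘ.*≡* (cong (λ j → (+ 1 ℤ.+ j) ℤ.* + 1) (ℤ.*-identityʳ (+ k))))))

  below-fromℕ : ∀ p → ∃ λ k → p < fromℕ k
  below-fromℕ (mkℚ -[1+ a ] d _) = 0 , ℚ.*<* ℤ.-<+
  below-fromℕ (mkℚ (+ a)    d _) = suc a , ℚ.*<* (subst₂ ℤ._<_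
    (sym (ℤ.*-identityʳ (+ a))) (ℤ.pos-* (suc a) (suc d))
    (ℤ.+<+ (ℕ.m≤m*n (suc a) (suc d))))

  archimedean′ : ∀ p {δ} → 0ℚ < δ → ∃ λ k → p < k · δ
  archimedean′ p {δ} 0<δ = let (k , h) = below-fromℕ (p * recip δ) in k , (begin-strict
      p                    ≡⟨ ℚ.*-identityʳ p ⟨
      p * 1ℚ               ≡⟨ cong (p *_) (recip-inverseʳ 0<δ) ⟨
      p * (δ * recip δ)    ≡⟨ solve 3 (λ p d e → p :* (d :* e) := (p :* e) :* d) refl p δ (recip δ) ⟩
      p * recip δ * δ      <⟨ ℚ.*-monoˡ-<-pos δ {{ℚ.positive 0<δ}} h ⟩
      fromℕ k * δ          ≡⟨ cong (_* δ) (·-1 k) ⟨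
      (k · 1ℚ) * δ         ≡⟨ ·-*ʳ k 1ℚ δ ⟩
      k · (1ℚ * δ)         ≡⟨ cong (k ·_) (ℚ.*-identityˡ δ) ⟩
      k · δ                ∎)
    where open ℚ.≤-Reasoning

  root : ∀ s δ → 0ℚ ≤ s → 0ℚ < δ → ∃ (IsRoot s δ)
  root s δ 0≤s 0<δ = let (k , h) = archimedean′ (s + 1ℚ) 0<δ in
    root-search s δ k 0ℚ (ℚ.<⇒≤ 0<δ) ℚ.≤-refl 0≤s
    (<-by (1ℚ + (s * s + s + (k · δ - (s + 1ℚ)) * (k · δ + (s + 1ℚ))))
       (0<+ 0<1 (0≤+ (0≤+ (0≤sq s) 0≤s)
         (0≤* (≤⇒0≤ (ℚ.<⇒≤ h)) (0≤+ (·-nonNeg k (ℚ.<⇒≤ 0<δ)) (0≤+ 0≤s (ℚ.<⇒≤ 0<1))))))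
       (solve 2 (λ s K → s :+ (con 1ℚ :+ (s :* s :+ s :+ (K :- (s :+ con 1ℚ)) :* (K :+ (s :+ con 1ℚ))))
                   := (con 0ℚ :+ K) :* (con 0ℚ :+ K)) refl s (k · δ)))

  root-close : ∀ {s δ r s′ δ′ r′ h} → 0ℚ < h → 0ℚ ≤ δ → δ ≤ h →
               IsRoot s δ r → IsRoot s′ δ′ r′ → s′ - s < h * h → r′ - r < h + h
  root-close {s} {δ} {r} {s′} {δ′} {r′} {h} 0<h 0≤δ δ≤h (0≤r , _ , s<) (_ , r′²≤s′ , _) s′-s< =
    ℚ.≰⇒> λ r′-r≥ → ℚ.<-irrefl refl (ℚ.<-trans (s+h²<s′ r′-r≥) s′<s+h²)
    where
    open ℚ.≤-Reasoning
    s′<s+h² : s′ < s + h * h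
    s′<s+h² = <-by (h * h - (s′ - s)) (<⇒0< s′-s<)
      (solve 3 (λ s s′ h → s′ :+ (h :* h :- (s′ :- s)) := s :+ h :* h) refl s s′ h)
    u = r + δ
    d = (r′ - r - (h + h)) + (h - δ)
    0≤u : 0ℚ ≤ u
    0≤u = 0≤+ 0≤r 0≤δ
    0≤h : 0ℚ ≤ h
    0≤h = ℚ.<⇒≤ 0<h
    s+h²<s′ : h + h ≤ r′ - r → s + h * h < s′
    s+h²<s′ r′-r≥ = begin-strict
      s + h * h      <⟨ ℚ.+-monoˡ-< (h * h) s< ⟩
      u * u + h * h  ≤⟨ ≤-by (u * (h + d) + u * (h + d) + (h * d + h * d + d * d))
                          (0≤+ (0≤+ (0≤* 0≤u (0≤+ 0≤h 0≤d)) (0≤* 0≤u (0≤+ 0≤h 0≤d)))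
                               (0≤+ (0≤+ (0≤* 0≤h 0≤d) (0≤* 0≤h 0≤d)) (0≤sq d)))
                          (solve 4 (λ r δ r′ h →
                             let u = r :+ δ
                                 d = (r′ :- r :- (h :+ h)) :+ (h :- δ)
                             in u :* u :+ h :* h :+ (u :* (h :+ d) :+ u :* (h :+ d)
                                                      :+ (h :* d :+ h :* d :+ d :* d))
                                := r′ :* r′) refl r δ r′ h) ⟩
      r′ * r′        ≤⟨ r′²≤s′ ⟩
      s′             ∎
      where
      0≤d : 0ℚ ≤ d
      0≤d = 0≤+ (≤⇒0≤ r′-r≥) (≤⇒0≤ δ≤h)

  NonNegᴿ : ℝ → Set
  NonNegᴿ x = ∀ n → 0ℚ ≤ seq x n

  opaque
    √-root : ∀ x → NonNegᴿ x → ∀ n → ∃ (IsRoot (seq x n) (1/1+ n))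
    √-root x 0≤x n = root (seq x n) (1/1+ n) (0≤x n) (0<1/1+ n)

    √-isCauchy : ∀ x (0≤x : NonNegᴿ x) → IsCauchy (λ n → proj₁ (√-root x 0≤x n))
    √-isCauchy x 0≤x ε 0<ε =
      let (M , small) = archimedean (0<half 0<ε)
          (N , h) = isCauchy x (ε * ½ * (ε * ½)) (0<* (0<half 0<ε) (0<half 0<ε))
          r = λ k → proj₁ (√-root x 0≤x k)
          close : ∀ j k → M ℕ.⊔ N ℕ.≤ j → M ℕ.⊔ N ℕ.≤ k → r k - r j < ε
          close j k j≥ k≥ = subst (r k - r j <_) (half+half ε)
            (root-close (0<half 0<ε) (ℚ.<⇒≤ (0<1/1+ j)) (small j (ℕ.m⊔n≤o⇒m≤o M N j≥))
              (proj₂ (√-root x 0≤x j)) (proj₂ (√-root x 0≤x k))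
              (ℚ.≤-<-trans (p≤∣p∣ (seq x k - seq x j))
                (h k j (ℕ.m⊔n≤o⇒n≤o M N k≥) (ℕ.m⊔n≤o⇒n≤o M N j≥))))
      in M ℕ.⊔ N , λ m n m≥ n≥ → ∣∣<-intro (close n m n≥ m≥)
           (subst (_< ε) (solve 2 (λ a b → a :- b := :- (b :- a)) refl (r n) (r m))
             (close m n m≥ n≥))

  -- Its n-th term is a root of the n-th term of x up to 1 / (n + 1); as the
  -- terms of x converge, so do these.
  √ : ∀ x → NonNegᴿ x → ℝ
  √ x 0≤x = mkℝ (λ n → proj₁ (√-root x 0≤x n)) (√-isCauchy x 0≤x)

  √<1⇒<1 : ∀ x 0≤x → √ x 0≤x <ᴿ 1ᴿ → x <ᴿ 1ᴿ
  √<1⇒<1 x 0≤x (ε , 0<ε , N , h) = let (M , small) = archimedean (0<half 0<ε) in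
    ε * ½ , 0<half 0<ε , M ℕ.⊔ N , λ n n≥ →
    let (r , 0≤r , _ , s<) = √-root x 0≤x n
        s = seq x n
        δ = 1/1+ n
        g = ε * ½
        0≤r+δ = 0≤+ 0≤r (ℚ.<⇒≤ (0<1/1+ n))
        gap = ≤⇒0≤ (h n (ℕ.m⊔n≤o⇒n≤o M N n≥))
        0≤g-δ = ≤⇒0≤ (small n (ℕ.m⊔n≤o⇒m≤o M N n≥))
        -- c = 1 - (r + δ) - g, so that 1 - g - (r+δ)² = c + (r+δ)(g + c)
        c = (1ℚ - (r + ε)) + (g - δ)
        0≤c = 0≤+ gap 0≤g-δ
        0≤g = ℚ.<⇒≤ (0<half 0<ε)
    in ≤-by (((r + δ) * (r + δ) - s) + (c + (r + δ) * (g + c)))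
         (0≤+ (ℚ.<⇒≤ (<⇒0< s<)) (0≤+ 0≤c (0≤* 0≤r+δ (0≤+ 0≤g 0≤c))))
         (solve 4 (λ s r δ ε →
            let g = ε :* con ½
                c = (con 1ℚ :- (r :+ ε)) :+ (g :- δ)
            in s :+ g :+ (((r :+ δ) :* (r :+ δ) :- s) :+ (c :+ (r :+ δ) :* (g :+ c)))
               := con 1ℚ) refl s r δ ε)

record ℂ : Set where
  no-eta-equality
  constructor _+i_
  field
    re im : ℝ

open ℂ public

infix  4 _≈_
infixl 6 _+_ _-_
infixl 7 _*_
infix  8 -_

_≈_ : ℂ → ℂ → Set
z ≈ w = re z ≈ᴿ re w × im z ≈ᴿ im w

0ℂ 1ℂ : ℂ
0ℂ = 0ᴿ +i 0ᴿ
1ℂ = 1ᴿ +i 0ᴿ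

opaque
  -_ : ℂ → ℂ
  - z = (-ᴿ re z) +i (-ᴿ im z)

  _+_ _*_ : ℂ → ℂ → ℂ
  z + w = (re z +ᴿ re w) +i (im z +ᴿ im w)
  z * w = (re z *ᴿ re w +ᴿ (-ᴿ (im z *ᴿ im w))) +i (re z *ᴿ im w +ᴿ im z *ᴿ re w)

_-_ : ℂ → ℂ → ℂ
z - w = z + (- w)

ℂ-rawRing : RawRing 0ℓ 0ℓ
ℂ-rawRing = record
  { Carrier = ℂ ; _≈_ = _≈_ ; _+_ = _+_ ; _*_ = _*_ ; -_ = -_ ; 0# = 0ℂ ; 1# = 1ℂ }

open import Algebra.Definitions.RawSemiring (RawRing.rawSemiring ℂ-rawRing) public
  using (_^_; sum; product)

normSq : ℂ → ℝ
normSq z = re z *ᴿ re z +ᴿ im z *ᴿ im z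

normSq-nonNeg : ∀ z → NonNegᴿ (normSq z)
normSq-nonNeg z n = 0≤+ (0≤sq (seq (re z) n)) (0≤sq (seq (im z) n))

∣_∣ : ℂ → ℝ
∣ z ∣ = √ (normSq z) (normSq-nonNeg z)

-- Being apart from zero; unlike ¬ (z ≈ 0ℂ) this is enough to invert z
-- constructively.
record NonZero (z : ℂ) : Set where
  constructor nonZero
  field
    0<normSq : 0ᴿ <ᴿ normSq z

open NonZero public

opaque
  recipℂ : ∀ z → NonZero z → ℂ
  recipℂ z z≉0 = (re z *ᴿ r) +i ((-ᴿ im z) *ᴿ r)
    where
    r : ℝ
    r = recipᴿ (normSq z) (0<normSq z≉0)

infixl 7 _/_[_]
_/_[_] : (z w : ℂ) → NonZero w → ℂ
z / w [ w≉0 ] = z * recipℂ w w≉0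

normSqℚ : ℂ → ℕ → ℚ
normSqℚ z = seq (normSq z)

opaque
  unfolding _*_

  normSq-* : ∀ z w n → normSqℚ (z * w) n ≡ normSqℚ z n ℚ.* normSqℚ w n
  normSq-* z w n = solve 4 (λ a b c d →
      (a :* c :+ :- (b :* d)) :* (a :* c :+ :- (b :* d)) :+ (a :* d :+ b :* c) :* (a :* d :+ b :* c)
        := (a :* a :+ b :* b) :* (c :* c :+ d :* d)) refl
    (seq (re z) n) (seq (im z) n) (seq (re w) n) (seq (im w) n)

1-nonZero : NonZero 1ℂ
1-nonZero = nonZero (1ℚ , 0<1 , 0 , λ _ _ → ℚ.≤-refl)

*-nonZero : ∀ {z w} → NonZero z → NonZero w → NonZero (z * w)
*-nonZero {z} {w} (nonZero (ε , 0<ε , M , hz)) (nonZero (η , 0<η , N , hw)) =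
  nonZero (ε ℚ.* η , 0<* 0<ε 0<η , M ℕ.⊔ N , λ n n≥ →
    let a = normSqℚ z n
        b = normSqℚ w n
        0≤a-ε = ≤⇒0≤ (hz n (ℕ.m⊔n≤o⇒m≤o M N n≥))
        0≤b-η = ≤⇒0≤ (hw n (ℕ.m⊔n≤o⇒n≤o M N n≥))
    in subst (0ℚ ℚ.+ ε ℚ.* η ℚ.≤_) (sym (normSq-* z w n))
         (≤-by ((a ℚ.- (0ℚ ℚ.+ ε)) ℚ.* b ℚ.+ ε ℚ.* (b ℚ.- (0ℚ ℚ.+ η)))
           (0≤+ (0≤* 0≤a-ε (normSq-nonNeg w n)) (0≤* (ℚ.<⇒≤ 0<ε) 0≤b-η))
           (*-gap a b ε η)))
  where
  *-gap : ∀ a b ε η → 0ℚ ℚ.+ ε ℚ.* η ℚ.+ ((a ℚ.- (0ℚ ℚ.+ ε)) ℚ.* b ℚ.+ ε ℚ.* (b ℚ.- (0ℚ ℚ.+ η)))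
                        ≡ a ℚ.* b
  *-gap = solve 4 (λ a b ε η →
    con 0ℚ :+ ε :* η :+ ((a :- (con 0ℚ :+ ε)) :* b :+ ε :* (b :- (con 0ℚ :+ η)))
    := a :* b) refl

product-nonZero : ∀ {n} (f : Vector ℂ n) → (∀ i → NonZero (f i)) → NonZero (product f)
product-nonZero {zero}  f h = 1-nonZero
product-nonZero {suc n} f h =
  *-nonZero (h zero) (product-nonZero (λ i → f (suc i)) (λ i → h (suc i)))

record InDisc (z : ℂ) : Set where
  constructor inDisc
  field
    normSq<1 : normSq z <ᴿ 1ᴿ

∣∣<1⇒InDisc : ∀ {z} → ∣ z ∣ <ᴿ 1ᴿ → InDisc z
∣∣<1⇒InDisc {z} ∣z∣<1 = inDisc (√<1⇒<1 (normSq z) (normSq-nonNeg z) ∣z∣<1)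

opaque
  unfolding _+_

  InDisc⇒1-nonZero : ∀ {z} → InDisc z → NonZero (1ℂ - z)
  InDisc⇒1-nonZero {z} (inDisc (ε , 0<ε , N , h)) =
    nonZero (ε ℚ.* ½ ℚ.* (ε ℚ.* ½) , 0<* (0<half 0<ε) (0<half 0<ε) , N , λ n n≥ →
      let a = seq (re z) n
          b = seq (im z) n
          g = ε ℚ.* ½
          d = gap a b
          0≤d = 0≤* (0≤+ (≤⇒0≤ (h n n≥)) (0≤+ (0≤sq (1ℚ ℚ.- a)) (0≤sq b))) (ℚ.<⇒≤ 0<½)
          0≤g = ℚ.<⇒≤ (0<half 0<ε)
      in ≤-by (g ℚ.* d ℚ.+ g ℚ.* d ℚ.+ d ℚ.* d ℚ.+ b ℚ.* b)
           (0≤+ (0≤+ (0≤+ (0≤* 0≤g 0≤d) (0≤* 0≤g 0≤d)) (0≤sq d)) (0≤sq b))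
           (identity a b))
    where
    -- Equal to 1 - a - ε / 2.
    gap : ℚ → ℚ → ℚ
    gap a b = ((1ℚ ℚ.- (a ℚ.* a ℚ.+ b ℚ.* b ℚ.+ ε))
                ℚ.+ ((1ℚ ℚ.- a) ℚ.* (1ℚ ℚ.- a) ℚ.+ b ℚ.* b)) ℚ.* ½

    identity : ∀ a b → let g = ε ℚ.* ½; d = gap a b in
      0ℚ ℚ.+ g ℚ.* g ℚ.+ (g ℚ.* d ℚ.+ g ℚ.* d ℚ.+ d ℚ.* d ℚ.+ b ℚ.* b)
        ≡ (1ℚ ℚ.- a) ℚ.* (1ℚ ℚ.- a) ℚ.+ (0ℚ ℚ.- b) ℚ.* (0ℚ ℚ.- b)
    identity a b = solve 3 (λ a b ε →
      let g = ε :* con ½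
          d = ((con 1ℚ :- (a :* a :+ b :* b :+ ε))
                :+ ((con 1ℚ :- a) :* (con 1ℚ :- a) :+ b :* b)) :* con ½
      in con 0ℚ :+ g :* g :+ (g :* d :+ g :* d :+ d :* d :+ b :* b)
         := (con 1ℚ :- a) :* (con 1ℚ :- a) :+ (con 0ℚ :- b) :* (con 0ℚ :- b)) refl a b ε

*-InDisc : ∀ {z w} → InDisc z → (∃ λ N → ∀ n → N ℕ.≤ n → normSqℚ w n ℚ.≤ 1ℚ) → InDisc (z * w)
*-InDisc {z} {w} (inDisc (ε , 0<ε , M , hz)) (N , hw) = inDisc (ε , 0<ε , M ℕ.⊔ N , λ n n≥ →
  let a = normSqℚ z n
      b = normSqℚ w n
  in subst (λ t → t ℚ.+ ε ℚ.≤ 1ℚ) (sym (normSq-* z w n))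
       (≤-by ((1ℚ ℚ.- (a ℚ.+ ε)) ℚ.+ a ℚ.* (1ℚ ℚ.- b))
         (0≤+ (≤⇒0≤ (hz n (ℕ.m⊔n≤o⇒m≤o M N n≥)))
              (0≤* (normSq-nonNeg z n) (≤⇒0≤ (hw n (ℕ.m⊔n≤o⇒n≤o M N n≥)))))
         (identity a b ε)))
  where
  identity : ∀ a b ε → a ℚ.* b ℚ.+ ε ℚ.+ ((1ℚ ℚ.- (a ℚ.+ ε)) ℚ.+ a ℚ.* (1ℚ ℚ.- b)) ≡ 1ℚ
  identity = solve 3 (λ a b ε →
    a :* b :+ ε :+ ((con 1ℚ :- (a :+ ε)) :+ a :* (con 1ℚ :- b)) := con 1ℚ) refl

InDisc⇒≤1 : ∀ {z} → InDisc z → ∃ λ N → ∀ n → N ℕ.≤ n → normSqℚ z n ℚ.≤ 1ℚ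
InDisc⇒≤1 {z} (inDisc (ε , 0<ε , N , h)) = N , λ n n≥ →
  ℚ.≤-trans (≤-by {normSqℚ z n} ε (ℚ.<⇒≤ 0<ε) refl) (h n n≥)

^-≤1 : ∀ {z} → InDisc z → ∀ k → ∃ λ N → ∀ n → N ℕ.≤ n → normSqℚ (z ^ k) n ℚ.≤ 1ℚ
^-≤1 {z} h zero    = 0 , λ _ _ → ℚ.≤-refl
^-≤1 {z} h (suc k) = InDisc⇒≤1 (*-InDisc {z} {z ^ k} h (^-≤1 h k))

opaque
  unfolding -_

  neg-InDisc : ∀ {z} → InDisc z → InDisc (- z)
  neg-InDisc {z} (inDisc (ε , 0<ε , N , h)) = inDisc (ε , 0<ε , N , λ n n≥ →
    subst (λ t → t ℚ.+ ε ℚ.≤ 1ℚ) (sq-neg (seq (re z) n) (seq (im z) n)) (h n n≥))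
    where
    sq-neg : ∀ a b → a ℚ.* a ℚ.+ b ℚ.* b ≡ (ℚ.- a) ℚ.* (ℚ.- a) ℚ.+ (ℚ.- b) ℚ.* (ℚ.- b)
    sq-neg = solve 2 (λ a b → a :* a :+ b :* b := (:- a) :* (:- a) :+ (:- b) :* (:- b)) refl

-- poch x p n is the p-shifted factorial (x;p)ₙ.
poch : ℂ → ℂ → ℕ → ℂ
poch x p n = product {n} λ i → 1ℂ - x * p ^ toℕ i

poch-nonZero : ∀ {x p} → InDisc x → InDisc p → ∀ n → NonZero (poch x p n)
poch-nonZero {x} {p} hx hp n = product-nonZero {n} (λ i → 1ℂ - x * p ^ toℕ i) λ i →
  InDisc⇒1-nonZero (*-InDisc {x} {p ^ toℕ i} hx (^-≤1 hp (toℕ i)))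

module _ (q : ℂ) (∣q∣<1 : ∣ q ∣ <ᴿ 1ᴿ) where

  q∈disc : InDisc q
  q∈disc = ∣∣<1⇒InDisc ∣q∣<1

  qq-nonZero : ∀ n → NonZero (poch q q n)
  qq-nonZero = poch-nonZero q∈disc q∈disc

  -qq-nonZero : ∀ n → NonZero (poch (- q) q n)
  -qq-nonZero = poch-nonZero (neg-InDisc q∈disc) q∈disc

  q²q²-nonZero : ∀ n → NonZero (poch (q ^ 2) (q ^ 2) n)
  q²q²-nonZero = poch-nonZero q²∈disc q²∈disc
    where
    q²∈disc : InDisc (q ^ 2)
    q²∈disc = *-InDisc q∈disc (^-≤1 q∈disc 1)

  -- The usual coefficient for k ≤ n; for k > n the subtraction truncates.
  qBinomial : ℕ → ℕ → ℂ
  qBinomial n k = poch q q n / (poch q q (n ℕ.∸ k) * poch q q k)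
    [ *-nonZero (qq-nonZero (n ℕ.∸ k)) (qq-nonZero k) ]

  U : ℕ → ℂ → ℂ
  U m x = sum {suc m} λ i → let k = toℕ i in
    qBinomial (m ℕ.+ k) k * (x ^ k / poch (- q) q k [ -qq-nonZero k ])

{-# OPTIONS --safe #-}
-- With (q;q)_k (-q;q)_k = (q²;q²)_k, the coefficient of x^k in U_m is
-- (q;q)_{m+k} / ((q;q)_m (q²;q²)_k), an expression which makes sense for every
-- k.  In terms of a = q^{m+1}, e = q^k and the common factor
-- (q;q)_{m+k} / ((q;q)_{m+1} (q²;q²)_k), the coefficient of x^k on the left is
--   (1 - ae)(1 - qae) + qa²(1 - e²) - (1 + q)(1 - ae) + q(1 + a)(1 - a) = 0.
-- Hence the left-hand side consists of the terms in which U_{m+1} and U_m stop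
-- short of k = m + 2, and these add up to the right-hand side.
module Submission where

open import Defs
open import Algebra.Bundles using (CommutativeRing; Monoid)
import Algebra.Definitions.RawMonoid as RawMonoidDefinitions
import Algebra.Properties.Monoid.Sum as MonoidSum
import Algebra.Properties.Semiring.Exp as SemiringExp
import Algebra.Solver.Ring as RingSolver
import Algebra.Solver.Ring.AlmostCommutativeRing as ACR
open import Data.Fin.Base using (toℕ)
open import Data.Maybe.Base using (Maybe; just; nothing)
open import Data.Nat.Base as ℕ using (ℕ; zero; suc)
import Data.Nat.Properties as ℕ
import Data.Nat.Solver as ℕ
open import Data.Product.Base using (∃; _,_)
open import Data.Rational.Base as ℚ using (ℚ; 0ℚ; 1ℚ; ½)
import Data.Rational.Properties as ℚ
import Data.Rational.Solver as ℚ
open import Data.Vec.Functional using (Vector)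
open import Level using (0ℓ)
open import Relation.Binary.PropositionalEquality as ≡ using (_≡_)
open import Relation.Binary.Structures using (IsEquivalence)
import Relation.Binary.Reasoning.Setoid as SetoidReasoning
open import Relation.Nullary using (yes; no)

private
  module ℕS = ℕ.+-*-Solver
  module ℚS = ℚ.+-*-Solver

-- Equality of reals as a congruence.

eventually≡⇒≈ᴿ : ∀ {x y} → (∃ λ N → ∀ n → N ℕ.≤ n → seq x n ≡ seq y n) → x ≈ᴿ y
eventually≡⇒≈ᴿ {x} {y} (N , eq) ε 0<ε = N , λ n n≥ →
  ≡.subst (λ d → ℚ.∣ d ∣ ℚ.< ε)
    (≡.sym (≡.trans (≡.cong (ℚ._- seq y n) (eq n n≥)) (ℚ.+-inverseʳ (seq y n)))) 0<ε

≡⇒≈ᴿ : ∀ {x y} → (∀ n → seq x n ≡ seq y n) → x ≈ᴿ y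
≡⇒≈ᴿ {x} {y} eq = eventually≡⇒≈ᴿ {x} {y} (0 , λ n _ → eq n)

≈ᴿ-sym : ∀ {x y} → x ≈ᴿ y → y ≈ᴿ x
≈ᴿ-sym {x} {y} x≈y ε 0<ε = let (N , h) = x≈y ε 0<ε in N , λ n n≥ →
  ≡.subst (ℚ._< ε)
    (≡.trans (≡.sym (ℚ.∣-p∣≡∣p∣ (seq x n ℚ.- seq y n)))
      (≡.cong ℚ.∣_∣ (solve 2 (λ a b → :- (a :- b) := b :- a) ≡.refl (seq x n) (seq y n))))
    (h n n≥)
  where open ℚS using (solve; :-_; _:-_; _:=_)

+ᴿ-cong : ∀ {x x′ y y′} → x ≈ᴿ x′ → y ≈ᴿ y′ → x +ᴿ y ≈ᴿ x′ +ᴿ y′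
+ᴿ-cong {x} {x′} {y} {y′} x≈x′ y≈y′ ε 0<ε =
  let (M , hx) = x≈x′ (ε ℚ.* ½) (0<half 0<ε)
      (N , hy) = y≈y′ (ε ℚ.* ½) (0<half 0<ε)
  in M ℕ.⊔ N , λ n n≥ → begin-strict
    ℚ.∣ (seq x n ℚ.+ seq y n) ℚ.- (seq x′ n ℚ.+ seq y′ n) ∣
      ≡⟨ ≡.cong ℚ.∣_∣ (solve 4 (λ a b c d → (a :+ b) :- (c :+ d) := (a :- c) :+ (b :- d)) ≡.refl
                        (seq x n) (seq y n) (seq x′ n) (seq y′ n)) ⟩
    ℚ.∣ (seq x n ℚ.- seq x′ n) ℚ.+ (seq y n ℚ.- seq y′ n) ∣
      ≤⟨ ℚ.∣p+q∣≤∣p∣+∣q∣ (seq x n ℚ.- seq x′ n) (seq y n ℚ.- seq y′ n) ⟩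
    ℚ.∣ seq x n ℚ.- seq x′ n ∣ ℚ.+ ℚ.∣ seq y n ℚ.- seq y′ n ∣
      <⟨ ℚ.+-mono-< (hx n (ℕ.m⊔n≤o⇒m≤o M N n≥)) (hy n (ℕ.m⊔n≤o⇒n≤o M N n≥)) ⟩
    ε ℚ.* ½ ℚ.+ ε ℚ.* ½
      ≡⟨ half+half ε ⟩
    ε ∎
  where
  open ℚ.≤-Reasoning
  open ℚS using (solve; _:+_; _:-_; _:=_)

-- In the difference of `x + y` and `y + z` the middle `y` cancels, so the splitting of `ε` done for
-- sums also gives transitivity.
≈ᴿ-trans : ∀ {x y z} → x ≈ᴿ y → y ≈ᴿ z → x ≈ᴿ z
≈ᴿ-trans {x} {y} {z} x≈y y≈z ε 0<ε =
  let (N , h) = +ᴿ-cong {x} {y} {y} {z} x≈y y≈z ε 0<ε in N , λ n n≥ →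
  ≡.subst (λ d → ℚ.∣ d ∣ ℚ.< ε)
    (solve 3 (λ a b c → (a :+ b) :- (b :+ c) := a :- c) ≡.refl (seq x n) (seq y n) (seq z n))
    (h n n≥)
  where open ℚS using (solve; _:+_; _:-_; _:=_)

-ᴿ-cong : ∀ {x y} → x ≈ᴿ y → -ᴿ x ≈ᴿ -ᴿ y
-ᴿ-cong {x} {y} x≈y ε 0<ε = let (N , h) = x≈y ε 0<ε in N , λ n n≥ →
  ≡.subst (ℚ._< ε)
    (≡.trans (≡.sym (ℚ.∣-p∣≡∣p∣ (seq x n ℚ.- seq y n)))
      (≡.cong ℚ.∣_∣ (solve 2 (λ a b → :- (a :- b) := (:- a) :- (:- b)) ≡.refl (seq x n) (seq y n))))
    (h n n≥)
  where open ℚS using (solve; :-_; _:-_; _:=_)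

-- The terms of `y` are eventually bounded by some `B > 0`, so it is enough that those of `x` and
-- `x′` come within `ε / B`.
*ᴿ-congʳ : ∀ {x x′} y → x ≈ᴿ x′ → x *ᴿ y ≈ᴿ x′ *ᴿ y
*ᴿ-congʳ {x} {x′} y x≈x′ ε 0<ε =
  let (B , 0<B , M , y≤B) = eventually-bounded (seq y) (isCauchy y)
      (N , h) = x≈x′ (ε ℚ.* recip B) (0<* 0<ε (0<recip 0<B))
  in M ℕ.⊔ N , λ n n≥ →
    let d = seq x n ℚ.- seq x′ n in begin-strict
    ℚ.∣ seq x n ℚ.* seq y n ℚ.- seq x′ n ℚ.* seq y n ∣
      ≡⟨ ≡.cong ℚ.∣_∣ (solve 3 (λ a b c → a :* c :- b :* c := (a :- b) :* c) ≡.refl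
                        (seq x n) (seq x′ n) (seq y n)) ⟩
    ℚ.∣ d ℚ.* seq y n ∣
      ≡⟨ ℚ.∣p*q∣≡∣p∣*∣q∣ d (seq y n) ⟩
    ℚ.∣ d ∣ ℚ.* ℚ.∣ seq y n ∣
      ≤⟨ ℚ.*-monoˡ-≤-nonNeg ℚ.∣ d ∣ {{ℚ.∣-∣-nonNeg d}} (y≤B n (ℕ.m⊔n≤o⇒m≤o M N n≥)) ⟩
    ℚ.∣ d ∣ ℚ.* B
      <⟨ ℚ.*-monoˡ-<-pos B {{ℚ.positive 0<B}} (h n (ℕ.m⊔n≤o⇒n≤o M N n≥)) ⟩
    ε ℚ.* recip B ℚ.* B
      ≡⟨ solve 3 (λ e r b → e :* r :* b := e :* (b :* r)) ≡.refl ε (recip B) B ⟩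
    ε ℚ.* (B ℚ.* recip B)
      ≡⟨ ≡.cong (ε ℚ.*_) (recip-inverseʳ 0<B) ⟩
    ε ℚ.* 1ℚ
      ≡⟨ ℚ.*-identityʳ ε ⟩
    ε ∎
  where
  open ℚ.≤-Reasoning
  open ℚS using (solve; _:*_; _:-_; _:=_)

*ᴿ-comm : ∀ x y → x *ᴿ y ≈ᴿ y *ᴿ x
*ᴿ-comm x y = ≡⇒≈ᴿ {x *ᴿ y} {y *ᴿ x} λ n → ℚ.*-comm (seq x n) (seq y n)

*ᴿ-cong : ∀ {x x′ y y′} → x ≈ᴿ x′ → y ≈ᴿ y′ → x *ᴿ y ≈ᴿ x′ *ᴿ y′
*ᴿ-cong {x} {x′} {y} {y′} x≈x′ y≈y′ =
  ≈ᴿ-trans {x *ᴿ y} {x′ *ᴿ y} {x′ *ᴿ y′} (*ᴿ-congʳ {x} {x′} y x≈x′)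
    (≈ᴿ-trans {x′ *ᴿ y} {y *ᴿ x′} {x′ *ᴿ y′} (*ᴿ-comm x′ y)
      (≈ᴿ-trans {y *ᴿ x′} {y′ *ᴿ x′} {x′ *ᴿ y′} (*ᴿ-congʳ {y} {y′} x′ y≈y′) (*ᴿ-comm y′ x′)))

-- The commutative ring of complex numbers.

infix 4 _≋_

-- Since _≈_ reduces to statements about real and imaginary parts, implicit
-- arguments cannot be inferred from it; from this copy they can.
record _≋_ (z w : ℂ) : Set where
  constructor ⟪_⟫
  field
    unwrap : z ≈ w

open _≋_

termwise : ∀ {z w} → (∀ n → seq (re z) n ≡ seq (re w) n) → (∀ n → seq (im z) n ≡ seq (im w) n) →
           z ≋ w
termwise {z} {w} eqʳ eqⁱ = ⟪ ≡⇒≈ᴿ {re z} {re w} eqʳ , ≡⇒≈ᴿ {im z} {im w} eqⁱ ⟫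

≋-isEquivalence : IsEquivalence _≋_
≋-isEquivalence = record
  { refl  = termwise (λ _ → ≡.refl) (λ _ → ≡.refl)
  ; sym   = λ { {z} {w} ⟪ p , q ⟫ →
      ⟪ ≈ᴿ-sym {re z} {re w} p , ≈ᴿ-sym {im z} {im w} q ⟫ }
  ; trans = λ { {u} {v} {w} ⟪ p , q ⟫ ⟪ p′ , q′ ⟫ →
      ⟪ ≈ᴿ-trans {re u} {re v} {re w} p p′ , ≈ᴿ-trans {im u} {im v} {im w} q q′ ⟫ }
  }

-- These constants are the coefficients for the ring solver: equality of rationals is decidable, so
-- like monomials can cancel.
fromℚ : ℚ → ℂ
fromℚ p = mkℝ (λ _ → p) (const-isCauchy p) +i 0ᴿ

opaque
  unfolding _+_

  +-cong : ∀ {z z′ w w′} → z ≋ z′ → w ≋ w′ → z + w ≋ z′ + w′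
  +-cong {z} {z′} {w} {w′} ⟪ p , q ⟫ ⟪ p′ , q′ ⟫ =
    ⟪ +ᴿ-cong {re z} {re z′} {re w} {re w′} p p′ , +ᴿ-cong {im z} {im z′} {im w} {im w′} q q′ ⟫

  -‿cong : ∀ {z w} → z ≋ w → - z ≋ - w
  -‿cong {z} {w} ⟪ p , q ⟫ = ⟪ -ᴿ-cong {re z} {re w} p , -ᴿ-cong {im z} {im w} q ⟫

  *-cong : ∀ {z z′ w w′} → z ≋ z′ → w ≋ w′ → z * w ≋ z′ * w′
  *-cong {z} {z′} {w} {w′} ⟪ p , q ⟫ ⟪ p′ , q′ ⟫ =
    ⟪ +ᴿ-cong {re z *ᴿ re w} {re z′ *ᴿ re w′} { -ᴿ (im z *ᴿ im w)} { -ᴿ (im z′ *ᴿ im w′)}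
        (*ᴿ-cong {re z} {re z′} {re w} {re w′} p p′)
        (-ᴿ-cong {im z *ᴿ im w} {im z′ *ᴿ im w′} (*ᴿ-cong {im z} {im z′} {im w} {im w′} q q′))
    , +ᴿ-cong {re z *ᴿ im w} {re z′ *ᴿ im w′} {im z *ᴿ re w} {im z′ *ᴿ re w′}
        (*ᴿ-cong {re z} {re z′} {im w} {im w′} p q′)
        (*ᴿ-cong {im z} {im z′} {re w} {re w′} q p′) ⟫

  +-assoc : ∀ u v w → (u + v) + w ≋ u + (v + w)
  +-assoc u v w = termwise (λ n → ℚ.+-assoc (seq (re u) n) (seq (re v) n) (seq (re w) n))
                           (λ n → ℚ.+-assoc (seq (im u) n) (seq (im v) n) (seq (im w) n))

  +-comm : ∀ z w → z + w ≋ w + z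
  +-comm z w = termwise (λ n → ℚ.+-comm (seq (re z) n) (seq (re w) n))
                        (λ n → ℚ.+-comm (seq (im z) n) (seq (im w) n))

  +-identityˡ : ∀ z → 0ℂ + z ≋ z
  +-identityˡ z = termwise (λ n → ℚ.+-identityˡ (seq (re z) n)) (λ n → ℚ.+-identityˡ (seq (im z) n))

  -‿inverseˡ : ∀ z → - z + z ≋ 0ℂ
  -‿inverseˡ z = termwise (λ n → ℚ.+-inverseˡ (seq (re z) n)) (λ n → ℚ.+-inverseˡ (seq (im z) n))

  *-assoc : ∀ u v w → (u * v) * w ≋ u * (v * w)
  *-assoc u v w = termwise
    (λ n → solve 6 (λ a b c d e f →
        (a :* c :- b :* d) :* e :- (a :* d :+ b :* c) :* f
          := a :* (c :* e :- d :* f) :- b :* (c :* f :+ d :* e)) ≡.refl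
      (seq (re u) n) (seq (im u) n) (seq (re v) n) (seq (im v) n) (seq (re w) n) (seq (im w) n))
    (λ n → solve 6 (λ a b c d e f →
        (a :* c :- b :* d) :* f :+ (a :* d :+ b :* c) :* e
          := a :* (c :* f :+ d :* e) :+ b :* (c :* e :- d :* f)) ≡.refl
      (seq (re u) n) (seq (im u) n) (seq (re v) n) (seq (im v) n) (seq (re w) n) (seq (im w) n))
    where open ℚS using (solve; _:+_; _:*_; _:-_; _:=_)

  *-comm : ∀ z w → z * w ≋ w * z
  *-comm z w = termwise
    (λ n → solve 4 (λ a b c d → a :* c :- b :* d := c :* a :- d :* b) ≡.refl
      (seq (re z) n) (seq (im z) n) (seq (re w) n) (seq (im w) n))
    (λ n → solve 4 (λ a b c d → a :* d :+ b :* c := c :* b :+ d :* a) ≡.refl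
      (seq (re z) n) (seq (im z) n) (seq (re w) n) (seq (im w) n))
    where open ℚS using (solve; _:+_; _:*_; _:-_; _:=_)

  *-identityˡ : ∀ z → 1ℂ * z ≋ z
  *-identityˡ z = termwise
    (λ n → solve 2 (λ a b → con 1ℚ :* a :- con 0ℚ :* b := a) ≡.refl (seq (re z) n) (seq (im z) n))
    (λ n → solve 2 (λ a b → con 1ℚ :* b :+ con 0ℚ :* a := b) ≡.refl (seq (re z) n) (seq (im z) n))
    where open ℚS using (solve; _:+_; _:*_; _:-_; _:=_; con)

  *-distribʳ-+ : ∀ u v w → (v + w) * u ≋ v * u + w * u
  *-distribʳ-+ u v w = termwise
    (λ n → solve 6 (λ a b c d e f →
        (c :+ e) :* a :- (d :+ f) :* b := (c :* a :- d :* b) :+ (e :* a :- f :* b)) ≡.refl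
      (seq (re u) n) (seq (im u) n) (seq (re v) n) (seq (im v) n) (seq (re w) n) (seq (im w) n))
    (λ n → solve 6 (λ a b c d e f →
        (c :+ e) :* b :+ (d :+ f) :* a := (c :* b :+ d :* a) :+ (e :* b :+ f :* a)) ≡.refl
      (seq (re u) n) (seq (im u) n) (seq (re v) n) (seq (im v) n) (seq (re w) n) (seq (im w) n))
    where open ℚS using (solve; _:+_; _:*_; _:-_; _:=_)

  fromℚ-+ : ∀ p q → fromℚ (p ℚ.+ q) ≋ fromℚ p + fromℚ q
  fromℚ-+ p q = termwise (λ _ → ≡.refl) (λ _ → ≡.refl)

  fromℚ-* : ∀ p q → fromℚ (p ℚ.* q) ≋ fromℚ p * fromℚ q
  fromℚ-* p q = termwise
    (λ _ → solve 2 (λ a b → a :* b := a :* b :- con 0ℚ :* con 0ℚ) ≡.refl p q)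
    (λ _ → solve 2 (λ a b → con 0ℚ := a :* con 0ℚ :+ con 0ℚ :* b) ≡.refl p q)
    where open ℚS using (solve; _:+_; _:*_; _:-_; _:=_; con)

  fromℚ-neg : ∀ p → fromℚ (ℚ.- p) ≋ - fromℚ p
  fromℚ-neg p = termwise (λ _ → ≡.refl) (λ _ → ≡.refl)

opaque
  unfolding _*_ recipℂ

  -- The real part is the squared norm times its reciprocal. This is 1 only from the index `N` on,
  -- where the squared norm is known to be at least `ε`; earlier terms may hit the junk value of
  -- `recip`. The imaginary part cancels whatever the value of `recip` is.
  recipℂ-inverseʳ : ∀ z (z≉0 : NonZero z) → z * recipℂ z z≉0 ≋ 1ℂ
  recipℂ-inverseʳ z z≉0@(nonZero (ε , 0<ε , N , h)) =
    ⟪ eventually≡⇒≈ᴿ {re (z * recipℂ z z≉0)} {1ᴿ} (N , λ n n≥ → ≡.trans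
        (solve 3 (λ a b r → a :* (a :* r) :- b :* ((:- b) :* r) := (a :* a :+ b :* b) :* r) ≡.refl
          (seq (re z) n) (seq (im z) n) (recip (normSqℚ z n)))
        (recip-inverseʳ (ℚ.<-≤-trans (≡.subst (0ℚ ℚ.<_) (≡.sym (ℚ.+-identityˡ ε)) 0<ε) (h n n≥))))
    , ≡⇒≈ᴿ {im (z * recipℂ z z≉0)} {0ᴿ} (λ n →
        solve 3 (λ a b r → a :* ((:- b) :* r) :+ b :* (a :* r) := con 0ℚ) ≡.refl
          (seq (re z) n) (seq (im z) n) (recip (normSqℚ z n))) ⟫
    where open ℚS using (solve; _:+_; _:*_; _:-_; :-_; _:=_; con)

ℂ-commutativeRing : CommutativeRing 0ℓ 0ℓ
ℂ-commutativeRing = record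
  { Carrier = ℂ ; _≈_ = _≋_ ; _+_ = _+_ ; _*_ = _*_ ; -_ = -_ ; 0# = 0ℂ ; 1# = 1ℂ
  ; isCommutativeRing = record
    { isRing = record
      { +-isAbelianGroup = record
        { isGroup = record
          { isMonoid = record
            { isSemigroup = record
              { isMagma = record { isEquivalence = ≋-isEquivalence ; ∙-cong = +-cong }
              ; assoc   = +-assoc }
            ; identity = +-identityˡ , λ z → ≋-trans (+-comm z 0ℂ) (+-identityˡ z) }
          ; inverse = -‿inverseˡ , λ z → ≋-trans (+-comm z (- z)) (-‿inverseˡ z)
          ; ⁻¹-cong = -‿cong }
        ; comm = +-comm }
      ; *-cong = *-cong
      ; *-assoc = *-assoc
      ; *-identity = *-identityˡ , λ z → ≋-trans (*-comm z 1ℂ) (*-identityˡ z)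
      ; distrib =
          (λ u v w → ≋-trans (*-comm u (v + w)) (≋-trans (*-distribʳ-+ u v w)
                       (+-cong (*-comm v u) (*-comm w u))))
        , *-distribʳ-+ }
    ; *-comm = *-comm }
  }
  where open IsEquivalence ≋-isEquivalence using () renaming (trans to ≋-trans)

open CommutativeRing ℂ-commutativeRing
  using (refl; sym; trans; reflexive; setoid; +-congˡ; +-congʳ; *-congˡ; *-congʳ; +-identityʳ; *-identityʳ;
         +-monoid; *-monoid; semiring)
open SetoidReasoning setoid
private module Exp = SemiringExp semiring
open MonoidSum +-monoid using (sum-cong-≋)

-- Ring solver over the complex numbers, and powers.

private
  ℂ-almostCommutativeRing : ACR.AlmostCommutativeRing 0ℓ 0ℓ
  ℂ-almostCommutativeRing = ACR.fromCommutativeRing ℂ-commutativeRing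

  fromℚ-morphism : ℚ.+-*-rawRing ACR.-Raw-AlmostCommutative⟶ ℂ-almostCommutativeRing
  fromℚ-morphism = record
    { ⟦_⟧ = fromℚ ; +-homo = fromℚ-+ ; *-homo = fromℚ-* ; -‿homo = fromℚ-neg
    ; 0-homo = refl ; 1-homo = refl }

  fromℚ-≟ : ∀ p q → Maybe (fromℚ p ≋ fromℚ q)
  fromℚ-≟ p q with p ℚ.≟ q
  ... | yes ≡.refl = just refl
  ... | no  _      = nothing

open RingSolver ℚ.+-*-rawRing ℂ-almostCommutativeRing fromℚ-morphism fromℚ-≟
  using (solve; _:+_; _:*_; _:-_; :-_; _:=_; con)

-- Powers formed with _≋_ and with _≈_ as the equality of ℂ are not
-- definitionally equal for a variable exponent.
^≡Exp^ : ∀ z n → z ^ n ≡ z Exp.^ n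
^≡Exp^ z zero    = ≡.refl
^≡Exp^ z (suc n) = ≡.cong (z *_) (^≡Exp^ z n)

^-homo-* : ∀ z m n → z ^ (m ℕ.+ n) ≋ z ^ m * z ^ n
^-homo-* z m n rewrite ^≡Exp^ z (m ℕ.+ n) | ^≡Exp^ z m | ^≡Exp^ z n = Exp.^-homo-* z m n

-- Reciprocals

recipℂ-unique : ∀ {z v} (z≉0 : NonZero z) → z * v ≋ 1ℂ → recipℂ z z≉0 ≋ v
recipℂ-unique {z} {v} z≉0 zv≋1 = begin
  r            ≈⟨ *-identityʳ r ⟨
  r * 1ℂ       ≈⟨ *-congˡ zv≋1 ⟨
  r * (z * v)  ≈⟨ solve 3 (λ r z v → r :* (z :* v) := (z :* r) :* v) refl r z v ⟩
  (z * r) * v  ≈⟨ *-congʳ (recipℂ-inverseʳ z z≉0) ⟩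
  1ℂ * v       ≈⟨ *-identityˡ v ⟩
  v            ∎
  where r = recipℂ z z≉0

-- Expands the fraction 1/z to the larger denominator `w`; this is how neighbouring coefficients are
-- brought to one denominator.
recipℂ-factor : ∀ {z v w} (z≉0 : NonZero z) (w≉0 : NonZero w) → w ≋ z * v →
                recipℂ z z≉0 ≋ v * recipℂ w w≉0
recipℂ-factor {z} {v} {w} z≉0 w≉0 w≋zv = recipℂ-unique z≉0 (begin
  z * (v * r)  ≈⟨ *-assoc z v r ⟨
  z * v * r    ≈⟨ *-congʳ w≋zv ⟨
  w * r        ≈⟨ recipℂ-inverseʳ w w≉0 ⟩
  1ℂ           ∎)
  where r = recipℂ w w≉0

recipℂ-* : ∀ {z w} (z≉0 : NonZero z) (w≉0 : NonZero w) (zw≉0 : NonZero (z * w)) →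
           recipℂ (z * w) zw≉0 ≋ recipℂ z z≉0 * recipℂ w w≉0
recipℂ-* {z} {w} z≉0 w≉0 zw≉0 = recipℂ-unique zw≉0 (begin
  z * w * (z⁻¹ * w⁻¹)    ≈⟨ solve 4 (λ z w r s → z :* w :* (r :* s) := (z :* r) :* (w :* s)) refl
                              z w z⁻¹ w⁻¹ ⟩
  (z * z⁻¹) * (w * w⁻¹)  ≈⟨ *-cong (recipℂ-inverseʳ z z≉0) (recipℂ-inverseʳ w w≉0) ⟩
  1ℂ * 1ℂ                ≈⟨ *-identityˡ 1ℂ ⟩
  1ℂ                     ∎)
  where
  z⁻¹ = recipℂ z z≉0
  w⁻¹ = recipℂ w w≉0

recipℂ-cong : ∀ {z w} (z≉0 : NonZero z) (w≉0 : NonZero w) → z ≋ w → recipℂ z z≉0 ≋ recipℂ w w≉0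
recipℂ-cong {z} {w} z≉0 w≉0 z≋w =
  recipℂ-unique z≉0 (trans (*-congʳ z≋w) (recipℂ-inverseʳ w w≉0))

-- Sums and products over initial segments

module _ {c ℓ} (M : Monoid c ℓ) where
  private
    open module M = Monoid M using (_∙_)
    fold : ∀ {n} → Vector M.Carrier n → M.Carrier
    fold = RawMonoidDefinitions.sum M.rawMonoid

  -- Sums and products split off their first entry by definition, while the inductions here add a
  -- last one. Working in a monoid serves both.
  fold-toℕ-suc : ∀ n (f : ℕ → M.Carrier) →
                 fold {suc n} (λ i → f (toℕ i)) M.≈ fold {n} (λ i → f (toℕ i)) ∙ f n
  fold-toℕ-suc zero    f = M.trans (M.identityʳ (f 0)) (M.sym (M.identityˡ (f 0)))
  fold-toℕ-suc (suc n) f =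
    M.trans (M.∙-congˡ (fold-toℕ-suc n (λ k → f (suc k)))) (M.sym (M.assoc _ _ _))

∑< : ℕ → (ℕ → ℂ) → ℂ
∑< n f = sum {n} λ i → f (toℕ i)

∑<-suc : ∀ n f → ∑< (suc n) f ≋ ∑< n f + f n
∑<-suc = fold-toℕ-suc +-monoid

-- Shifted factorials.

poch-suc : ∀ x p n → poch x p (suc n) ≋ poch x p n * (1ℂ - x * p ^ n)
poch-suc x p n = fold-toℕ-suc *-monoid n (λ k → 1ℂ - x * p ^ k)

poch-+ : ∀ x p m n → poch x p (m ℕ.+ n) ≋ poch x p m * poch (x * p ^ m) p n
poch-+ x p m zero    = trans (reflexive (≡.cong (poch x p) (ℕ.+-identityʳ m))) (sym (*-identityʳ _))
poch-+ x p m (suc n) = begin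
  poch x p (m ℕ.+ suc n)
    ≡⟨ ≡.cong (poch x p) (ℕ.+-suc m n) ⟩
  poch x p (suc (m ℕ.+ n))
    ≈⟨ poch-suc x p (m ℕ.+ n) ⟩
  poch x p (m ℕ.+ n) * (1ℂ - x * p ^ (m ℕ.+ n))
    ≈⟨ *-cong (poch-+ x p m n) (+-congˡ (-‿cong (*-congˡ (^-homo-* p m n)))) ⟩
  poch x p m * poch (x * p ^ m) p n * (1ℂ - x * (p ^ m * p ^ n))
    ≈⟨ solve 5 (λ A B x a b → A :* B :* (con 1ℚ :- x :* (a :* b))
                  := A :* (B :* (con 1ℚ :- x :* a :* b))) refl
         (poch x p m) (poch (x * p ^ m) p n) x (p ^ m) (p ^ n) ⟩
  poch x p m * (poch (x * p ^ m) p n * (1ℂ - x * p ^ m * p ^ n))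
    ≈⟨ *-congˡ (poch-suc (x * p ^ m) p n) ⟨
  poch x p m * poch (x * p ^ m) p (suc n) ∎

^2-^ : ∀ q k → (q ^ 2) ^ k ≋ q ^ k * q ^ k
^2-^ q zero    = sym (*-identityˡ 1ℂ)
^2-^ q (suc k) = trans (*-congˡ (^2-^ q k))
  (solve 2 (λ q e → q :* (q :* con 1ℚ) :* (e :* e) := q :* e :* (q :* e)) refl q (q ^ k))

-- The new factor is kept as a polynomial in `q ^ suc k`, so that the solver can factor it or cancel
-- it against powers of `q`.
poch-sq-suc : ∀ q k →
  poch (q ^ 2) (q ^ 2) (suc k) ≋ poch (q ^ 2) (q ^ 2) k * (1ℂ - q ^ suc k * q ^ suc k)
poch-sq-suc q k =
  trans (poch-suc (q ^ 2) (q ^ 2) k) (*-congˡ (+-congˡ (-‿cong (^2-^ q (suc k)))))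

-- Factor by factor this is the difference of squares, (1 - y)(1 + y) = 1 - y² with y = q^{j+1}.
poch-sq : ∀ q k → poch (q ^ 2) (q ^ 2) k ≋ poch q q k * poch (- q) q k
poch-sq q zero    = sym (*-identityˡ 1ℂ)
poch-sq q (suc k) = begin
  poch (q ^ 2) (q ^ 2) (suc k)
    ≈⟨ poch-sq-suc q k ⟩
  poch (q ^ 2) (q ^ 2) k * (1ℂ - q ^ suc k * q ^ suc k)
    ≈⟨ *-congʳ (poch-sq q k) ⟩
  poch q q k * poch (- q) q k * (1ℂ - q ^ suc k * q ^ suc k)
    ≈⟨ solve 4 (λ A B q e → A :* B :* (con 1ℚ :- q :* e :* (q :* e))
                  := A :* (con 1ℚ :- q :* e) :* (B :* (con 1ℚ :- (:- q) :* e))) refl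
         (poch q q k) (poch (- q) q k) q (q ^ k) ⟩
  poch q q k * (1ℂ - q * q ^ k) * (poch (- q) q k * (1ℂ - (- q) * q ^ k))
    ≈⟨ *-cong (poch-suc q q k) (poch-suc (- q) q k) ⟨
  poch q q (suc k) * poch (- q) q (suc k) ∎

-- The coefficients of U_m and their common factor.

module _ (q : ℂ) (∣q∣<1 : ∣ q ∣ <ᴿ 1ᴿ) where

  private
    P Q P⁻¹ Q⁻¹ : ℕ → ℂ
    P n = poch q q n
    Q n = poch (q ^ 2) (q ^ 2) n
    P⁻¹ n = recipℂ (P n) (qq-nonZero q ∣q∣<1 n)
    Q⁻¹ n = recipℂ (Q n) (q²q²-nonZero q ∣q∣<1 n)

  coeff : ℕ → ℕ → ℂ
  coeff m k = P (m ℕ.+ k) * (P⁻¹ m * Q⁻¹ k)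

  term : ℂ → ℕ → ℕ → ℂ
  term x m k = coeff m k * x ^ k

  -- The truncated subtraction is exact here, since `m + k ∸ k` is `m`. The factors 1/(q;q)_k and
  -- 1/(-q;q)_k then merge by `poch-sq`.
  U-term : ∀ m k x →
    qBinomial q ∣q∣<1 (m ℕ.+ k) k * (x ^ k / poch (- q) q k [ -qq-nonZero q ∣q∣<1 k ]) ≋ term x m k
  U-term m k x = begin
    P (m ℕ.+ k) * recipℂ (P (m ℕ.+ k ℕ.∸ k) * P k) denominator≉0 * (x ^ k * N⁻¹)
      ≈⟨ *-congʳ (*-congˡ (trans
           (recipℂ-cong denominator≉0 PmPk≉0 (*-congʳ (reflexive (≡.cong P (ℕ.m+n∸n≡m m k)))))
           (recipℂ-* (qq-nonZero q ∣q∣<1 m) (qq-nonZero q ∣q∣<1 k) PmPk≉0))) ⟩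
    P (m ℕ.+ k) * (P⁻¹ m * P⁻¹ k) * (x ^ k * N⁻¹)
      ≈⟨ solve 5 (λ p r s n X → p :* (r :* s) :* (X :* n) := p :* (r :* (s :* n)) :* X) refl
           (P (m ℕ.+ k)) (P⁻¹ m) (P⁻¹ k) N⁻¹ (x ^ k) ⟩
    P (m ℕ.+ k) * (P⁻¹ m * (P⁻¹ k * N⁻¹)) * x ^ k
      ≈⟨ *-congʳ (*-congˡ (*-congˡ (trans
           (recipℂ-cong (q²q²-nonZero q ∣q∣<1 k) PkNk≉0 (poch-sq q k))
           (recipℂ-* (qq-nonZero q ∣q∣<1 k) (-qq-nonZero q ∣q∣<1 k) PkNk≉0)))) ⟨
    term x m k ∎
    where
    N⁻¹ = recipℂ (poch (- q) q k) (-qq-nonZero q ∣q∣<1 k)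
    denominator≉0 = *-nonZero (qq-nonZero q ∣q∣<1 (m ℕ.+ k ℕ.∸ k)) (qq-nonZero q ∣q∣<1 k)
    PmPk≉0 = *-nonZero (qq-nonZero q ∣q∣<1 m) (qq-nonZero q ∣q∣<1 k)
    PkNk≉0 = *-nonZero (qq-nonZero q ∣q∣<1 k) (-qq-nonZero q ∣q∣<1 k)

  U-∑< : ∀ m x → U q ∣q∣<1 m x ≋ ∑< (suc m) (term x m)
  U-∑< m x = sum-cong-≋ {suc m} (λ i → U-term m (toℕ i) x)

  P⁻¹-suc : ∀ m → P⁻¹ m ≋ (1ℂ - q ^ suc m) * P⁻¹ (suc m)
  P⁻¹-suc m = recipℂ-factor (qq-nonZero q ∣q∣<1 m) (qq-nonZero q ∣q∣<1 (suc m)) (poch-suc q q m)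

  Q⁻¹-suc : ∀ k → Q⁻¹ k ≋ (1ℂ - q ^ suc k * q ^ suc k) * Q⁻¹ (suc k)
  Q⁻¹-suc k = recipℂ-factor (q²q²-nonZero q ∣q∣<1 k) (q²q²-nonZero q ∣q∣<1 (suc k)) (poch-sq-suc q k)

  -- The factor common to all coefficients of x ^ k in the recurrence for m.
  common : ℕ → ℕ → ℂ
  common m k = P (m ℕ.+ k) * (P⁻¹ (suc m) * Q⁻¹ k)

  coeff-m : ∀ m k → coeff m k ≋ (1ℂ - q ^ suc m) * common m k
  coeff-m m k = trans (*-congˡ (*-congʳ (P⁻¹-suc m)))
    (solve 4 (λ p u r s → p :* (u :* r :* s) := u :* (p :* (r :* s))) refl
       (P (m ℕ.+ k)) (1ℂ - q ^ suc m) (P⁻¹ (suc m)) (Q⁻¹ k))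

  P-suc-+ : ∀ m k → P (suc (m ℕ.+ k)) ≋ P (m ℕ.+ k) * (1ℂ - q ^ suc m * q ^ k)
  P-suc-+ m k = trans (poch-suc q q (m ℕ.+ k)) (*-congˡ (+-congˡ (-‿cong (^-homo-* q (suc m) k))))

  coeff-m+1 : ∀ m k → coeff (suc m) k ≋ (1ℂ - q ^ suc m * q ^ k) * common m k
  coeff-m+1 m k = trans (*-congʳ (P-suc-+ m k))
    (solve 3 (λ p u t → p :* u :* t := u :* (p :* t)) refl
       (P (m ℕ.+ k)) (1ℂ - q ^ suc m * q ^ k) (P⁻¹ (suc m) * Q⁻¹ k))

  -- For the part of the recurrence that multiplies U_{m+1} by x: there the coefficient of x^k
  -- contributes to x^{k+1}. The numerator already agrees with that of `common m (suc k)`, as m + 1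
  -- + k = m + (k + 1), so only (q²;q²)_k has to be expanded.
  coeff-m+1-pred : ∀ m k →
    coeff (suc m) k ≋ (1ℂ - q ^ suc k * q ^ suc k) * common m (suc k)
  coeff-m+1-pred m k = trans
    (*-cong (reflexive (≡.cong P (≡.sym (ℕ.+-suc m k)))) (*-congˡ (Q⁻¹-suc k)))
    (solve 4 (λ p r u s → p :* (r :* (u :* s)) := u :* (p :* (r :* s))) refl
       (P (m ℕ.+ suc k)) (P⁻¹ (suc m)) (1ℂ - q ^ suc k * q ^ suc k) (Q⁻¹ (suc k)))

  -- The multiplier from the recurrence cancels the last factor of (q;q)_{m+2}, leaving the
  -- denominator of `common`; the numerator exceeds that of `common` by two factors.
  coeff-m+2 : ∀ m k → (1ℂ - q ^ (2 ℕ.+ m)) * coeff (2 ℕ.+ m) k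
                        ≋ (1ℂ - q ^ suc m * q ^ k) * (1ℂ - q ^ (2 ℕ.+ m) * q ^ k) * common m k
  coeff-m+2 m k = begin
    u * (P (2 ℕ.+ m ℕ.+ k) * (P⁻¹ (2 ℕ.+ m) * Q⁻¹ k))
      ≈⟨ *-congˡ (*-congʳ (trans (P-suc-+ (suc m) k) (*-congʳ (P-suc-+ m k)))) ⟩
    u * (P (m ℕ.+ k) * v * w * (P⁻¹ (2 ℕ.+ m) * Q⁻¹ k))
      ≈⟨ solve 6 (λ u p v w r s → u :* (p :* v :* w :* (r :* s)) := v :* w :* (p :* ((u :* r) :* s)))
           refl u (P (m ℕ.+ k)) v w (P⁻¹ (2 ℕ.+ m)) (Q⁻¹ k) ⟩
    v * w * (P (m ℕ.+ k) * (u * P⁻¹ (2 ℕ.+ m) * Q⁻¹ k))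
      ≈⟨ *-congˡ (*-congˡ (*-congʳ (P⁻¹-suc (suc m)))) ⟨
    v * w * common m k ∎
    where
    u = 1ℂ - q ^ (2 ℕ.+ m)
    v = 1ℂ - q ^ suc m * q ^ k
    w = 1ℂ - q ^ (2 ℕ.+ m) * q ^ k

  -- Vanishing of the recurrence on partial sums.

  module _ (m : ℕ) (x : ℂ) where
    private
      a : ℂ
      a = q ^ suc m

    -- The left-hand side of the recurrence, with q^{2m+3} = q a². U_{m+1} gets two slots: its
    -- multiplier is split into `x * (q * (a * a))`, which raises the power of x, and `- (1ℂ + q)`,
    -- which does not, so the two parts need truncations of different length.
    combination : ℂ → ℂ → ℂ → ℂ → ℂ
    combination u v w z =
      (1ℂ - q * a) * u + x * (q * (a * a)) * v - (1ℂ + q) * w + q * (1ℂ + a) * z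

    combination-cong : ∀ {u u′ v v′ w w′ z z′} → u ≋ u′ → v ≋ v′ → w ≋ w′ → z ≋ z′ →
                       combination u v w z ≋ combination u′ v′ w′ z′
    combination-cong u≋ v≋ w≋ z≋ =
      +-cong (+-cong (+-cong (*-congˡ u≋) (*-congˡ v≋)) (-‿cong (*-congˡ w≋))) (*-congˡ z≋)

    combination-+ : ∀ u u′ v v′ w w′ z z′ →
      combination (u + u′) (v + v′) (w + w′) (z + z′) ≋ combination u v w z + combination u′ v′ w′ z′
    combination-+ u u′ v v′ w w′ z z′ =
      solve 12 (λ A B C D u u′ v v′ w w′ z z′ →
          A :* (u :+ u′) :+ B :* (v :+ v′) :- C :* (w :+ w′) :+ D :* (z :+ z′)
            := (A :* u :+ B :* v :- C :* w :+ D :* z) :+ (A :* u′ :+ B :* v′ :- C :* w′ :+ D :* z′)) refl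
        (1ℂ - q * a) (x * (q * (a * a))) (1ℂ + q) (q * (1ℂ + a)) u u′ v v′ w w′ z z′

    terms-zero : combination (term x (2 ℕ.+ m) 0) 0ℂ (term x (suc m) 0) (term x m 0) ≋ 0ℂ
    terms-zero = begin
      combination (coeff (2 ℕ.+ m) 0 * 1ℂ) 0ℂ (coeff (suc m) 0 * 1ℂ) (coeff m 0 * 1ℂ)
        ≈⟨ solve 6 (λ A B C D E c →
             A :* (c :* con 1ℚ) :+ B :* con 0ℚ :- C :* (D :* con 1ℚ) :+ E
               := A :* c :- C :* D :+ E) refl
             (1ℂ - q * a) (x * (q * (a * a))) (1ℂ + q) (coeff (suc m) 0)
             (q * (1ℂ + a) * (coeff m 0 * 1ℂ)) (coeff (2 ℕ.+ m) 0) ⟩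
      (1ℂ - q * a) * coeff (2 ℕ.+ m) 0 - (1ℂ + q) * coeff (suc m) 0
        + q * (1ℂ + a) * (coeff m 0 * 1ℂ)
        ≈⟨ +-cong (+-cong (coeff-m+2 m 0) (-‿cong (*-congˡ (coeff-m+1 m 0))))
                  (*-congˡ (*-congʳ (coeff-m m 0))) ⟩
      (1ℂ - a * 1ℂ) * (1ℂ - q * a * 1ℂ) * F - (1ℂ + q) * ((1ℂ - a * 1ℂ) * F)
        + q * (1ℂ + a) * ((1ℂ - a) * F * 1ℂ)
        -- The case e = 1 of the polynomial identity, where the factor 1 - e² of the absent shifted
        -- term vanishes.
        ≈⟨ solve 3 (λ q a F → let 1′ = con 1ℚ in
             (1′ :- a :* 1′) :* (1′ :- q :* a :* 1′) :* F :- (1′ :+ q) :* ((1′ :- a :* 1′) :* F)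
               :+ q :* (1′ :+ a) :* ((1′ :- a) :* F :* 1′) := con 0ℚ) refl q a F ⟩
      0ℂ ∎
      where F = common m 0

    terms-suc : ∀ k → combination (term x (2 ℕ.+ m) (suc k)) (term x (suc m) k)
                                  (term x (suc m) (suc k)) (term x m (suc k)) ≋ 0ℂ
    terms-suc k = begin
      combination (coeff (2 ℕ.+ m) (suc k) * (x * X)) (coeff (suc m) k * X)
                  (coeff (suc m) (suc k) * (x * X)) (coeff m (suc k) * (x * X))
        -- Regrouped so that 1 - q^{m+2} stands next to the coefficient, as `coeff-m+2` requires.
        ≈⟨ +-congʳ (+-congʳ (+-congʳ (*-assoc _ _ _))) ⟨
      (1ℂ - q * a) * coeff (2 ℕ.+ m) (suc k) * (x * X) + x * (q * (a * a)) * (coeff (suc m) k * X)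
        - (1ℂ + q) * (coeff (suc m) (suc k) * (x * X)) + q * (1ℂ + a) * (coeff m (suc k) * (x * X))
        ≈⟨ +-cong (+-cong (+-cong (*-congʳ (coeff-m+2 m (suc k)))
                                  (*-congˡ (*-congʳ (coeff-m+1-pred m k))))
                          (-‿cong (*-congˡ (*-congʳ (coeff-m+1 m (suc k))))))
                  (*-congˡ (*-congʳ (coeff-m m (suc k)))) ⟩
      (1ℂ - a * e) * (1ℂ - q * a * e) * F * (x * X) + x * (q * (a * a)) * ((1ℂ - e * e) * F * X)
        - (1ℂ + q) * ((1ℂ - a * e) * F * (x * X)) + q * (1ℂ + a) * ((1ℂ - a) * F * (x * X))
        ≈⟨ solve 6 (λ q a e F x X → let 1′ = con 1ℚ in
             (1′ :- a :* e) :* (1′ :- q :* a :* e) :* F :* (x :* X)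
               :+ x :* (q :* (a :* a)) :* ((1′ :- e :* e) :* F :* X)
               :- (1′ :+ q) :* ((1′ :- a :* e) :* F :* (x :* X))
               :+ q :* (1′ :+ a) :* ((1′ :- a) :* F :* (x :* X)) := con 0ℚ) refl q a e F x X ⟩
      0ℂ ∎
      where
      X = x ^ k
      e = q ^ suc k
      F = common m (suc k)

    -- The second sum is one term shorter because its terms are multiplied by x: all four parts then
    -- reach exactly x^n. No relation between n and m is needed, since `coeff` is defined for every
    -- index.
    partialSums : ∀ n → combination (∑< (suc n) (term x (2 ℕ.+ m))) (∑< n (term x (suc m)))
                                    (∑< (suc n) (term x (suc m))) (∑< (suc n) (term x m)) ≋ 0ℂ
    partialSums zero = trans
      (combination-cong (+-identityʳ _) refl (+-identityʳ _) (+-identityʳ _)) terms-zero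
    partialSums (suc n) = begin
      combination (∑< (2 ℕ.+ n) (term x (2 ℕ.+ m))) (∑< (suc n) (term x (suc m)))
                  (∑< (2 ℕ.+ n) (term x (suc m))) (∑< (2 ℕ.+ n) (term x m))
        ≈⟨ combination-cong (∑<-suc (suc n) (term x (2 ℕ.+ m))) (∑<-suc n (term x (suc m)))
                            (∑<-suc (suc n) (term x (suc m))) (∑<-suc (suc n) (term x m)) ⟩
      combination _ _ _ _
        ≈⟨ combination-+ _ _ _ _ _ _ _ _ ⟩
      combination (∑< (suc n) (term x (2 ℕ.+ m))) (∑< n (term x (suc m)))
                  (∑< (suc n) (term x (suc m))) (∑< (suc n) (term x m))
        + combination (term x (2 ℕ.+ m) (suc n)) (term x (suc m) n)
                      (term x (suc m) (suc n)) (term x m (suc n))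
        ≈⟨ +-cong (partialSums n) (terms-suc n) ⟩
      0ℂ + 0ℂ
        ≈⟨ +-identityˡ 0ℂ ⟩
      0ℂ ∎

    -- The boundary terms.

    C : ℂ
    C = poch (q ^ (2 ℕ.+ m)) q m * Q⁻¹ m

    P-double : P (m ℕ.+ suc m) ≋ P (suc m) * poch (q ^ (2 ℕ.+ m)) q m
    P-double = trans (reflexive (≡.cong P (ℕ.+-suc m m))) (poch-+ q q (suc m) m)

    -- The factor 1 - q^{2m+2} cancels the last one of (q²;q²)_{m+1}, and (q;q)_{2m+1} / (q;q)_{m+1}
    -- = (q^{m+2};q)_m.
    common-m+1 : (1ℂ - a * a) * common m (suc m) ≋ C
    common-m+1 = begin
      (1ℂ - a * a) * (P (m ℕ.+ suc m) * (P⁻¹ (suc m) * Q⁻¹ (suc m)))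
        ≈⟨ *-congˡ (*-congʳ P-double) ⟩
      (1ℂ - a * a) * (P (suc m) * R * (P⁻¹ (suc m) * Q⁻¹ (suc m)))
        ≈⟨ solve 5 (λ u p R r s → u :* (p :* R :* (r :* s)) := (p :* r) :* (R :* (u :* s))) refl
             (1ℂ - a * a) (P (suc m)) R (P⁻¹ (suc m)) (Q⁻¹ (suc m)) ⟩
      (P (suc m) * P⁻¹ (suc m)) * (R * ((1ℂ - a * a) * Q⁻¹ (suc m)))
        ≈⟨ *-cong (recipℂ-inverseʳ (P (suc m)) (qq-nonZero q ∣q∣<1 (suc m)))
                  (*-congˡ (sym (Q⁻¹-suc m))) ⟩
      1ℂ * (R * Q⁻¹ m)
        ≈⟨ *-identityˡ (R * Q⁻¹ m) ⟩
      C ∎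
      where R = poch (q ^ (2 ℕ.+ m)) q m

    -- Here 1 - q^{2m+4} cancels the last factor of (q²;q²)_{m+2}, and the extra factor 1 - q^{2m+2}
    -- of (q;q)_{2m+2} is the one that `common-m+1` absorbs. Hence both boundary powers carry the
    -- same constant.
    common-m+2 : (1ℂ - q * a * (q * a)) * common m (2 ℕ.+ m) ≋ C
    common-m+2 = begin
      u * (P (m ℕ.+ (2 ℕ.+ m)) * (P⁻¹ (suc m) * Q⁻¹ (2 ℕ.+ m)))
        ≈⟨ *-congˡ (*-congʳ (trans (reflexive (≡.cong P (ℕ.+-suc m (suc m)))) (P-suc-+ m (suc m)))) ⟩
      u * (P (m ℕ.+ suc m) * v * (P⁻¹ (suc m) * Q⁻¹ (2 ℕ.+ m)))
        ≈⟨ solve 5 (λ u p v r s → u :* (p :* v :* (r :* s)) := v :* (p :* (r :* (u :* s)))) refl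
             u (P (m ℕ.+ suc m)) v (P⁻¹ (suc m)) (Q⁻¹ (2 ℕ.+ m)) ⟩
      v * (P (m ℕ.+ suc m) * (P⁻¹ (suc m) * (u * Q⁻¹ (2 ℕ.+ m))))
        ≈⟨ *-congˡ (*-congˡ (*-congˡ (Q⁻¹-suc (suc m)))) ⟨
      v * common m (suc m)
        ≈⟨ common-m+1 ⟩
      C ∎
      where
      u = 1ℂ - q * a * (q * a)
      v = 1ℂ - a * a

    recurrence : (1ℂ - q * a) * U q ∣q∣<1 (2 ℕ.+ m) x
                   + (x * q ^ (2 ℕ.* m ℕ.+ 3) - q - 1ℂ) * U q ∣q∣<1 (suc m) x
                   + q * (1ℂ + a) * U q ∣q∣<1 m x
                 ≋ (x - q) * C * x ^ suc m
    recurrence = begin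
      (1ℂ - q * a) * U q ∣q∣<1 (2 ℕ.+ m) x
        + (x * q ^ (2 ℕ.* m ℕ.+ 3) - q - 1ℂ) * U q ∣q∣<1 (suc m) x
        + q * (1ℂ + a) * U q ∣q∣<1 m x
        ≈⟨ +-cong (+-cong (*-congˡ (U-∑< (2 ℕ.+ m) x))
                          (*-cong (+-congʳ (+-congʳ (*-congˡ q^[2m+3]))) (U-∑< (suc m) x)))
                  (*-congˡ (U-∑< m x)) ⟩
      (1ℂ - q * a) * S₂ + (x * (q * (a * a)) - q - 1ℂ) * S₁ + q * (1ℂ + a) * S₀
        -- Adds and subtracts the missing terms: `T` continues U_{m+1} to x^{m+2}, while `V` and `W`
        -- continue U_m to x^{m+1} and x^{m+2}.
        ≈⟨ solve 9 (λ q a x S₂ S₁ S₀ T V W → let 1′ = con 1ℚ in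
             (1′ :- q :* a) :* S₂ :+ (x :* (q :* (a :* a)) :- q :- 1′) :* S₁ :+ q :* (1′ :+ a) :* S₀
               := ((1′ :- q :* a) :* S₂ :+ x :* (q :* (a :* a)) :* S₁ :- (1′ :+ q) :* (S₁ :+ T)
                     :+ q :* (1′ :+ a) :* (S₀ :+ V :+ W))
                  :+ ((1′ :+ q) :* T :- q :* (1′ :+ a) :* (V :+ W))) refl
             q a x S₂ S₁ S₀ T V W ⟩
      combination S₂ S₁ (S₁ + T) (S₀ + V + W) + ((1ℂ + q) * T - q * (1ℂ + a) * (V + W))
        ≈⟨ +-cong telescoped (+-cong (*-congˡ (*-congʳ (coeff-m+1 m (2 ℕ.+ m))))
             (-‿cong (*-congˡ (+-cong (*-congʳ (coeff-m m (suc m))) (*-congʳ (coeff-m m (2 ℕ.+ m))))))) ⟩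
      0ℂ + ((1ℂ + q) * ((1ℂ - a * (q * a)) * G * (x * X))
              - q * (1ℂ + a) * ((1ℂ - a) * F * X + (1ℂ - a) * G * (x * X)))
        -- At x^{m+2} the two contributions combine by (1 + q)(1 - q a²) - q(1 - a²) = 1 - q² a²; at
        -- x^{m+1} only -q(1 - a²) remains.
        ≈⟨ solve 6 (λ q a x X F G → let 1′ = con 1ℚ in
             con 0ℚ :+ ((1′ :+ q) :* ((1′ :- a :* (q :* a)) :* G :* (x :* X))
               :- q :* (1′ :+ a) :* ((1′ :- a) :* F :* X :+ (1′ :- a) :* G :* (x :* X)))
             := x :* ((1′ :- q :* a :* (q :* a)) :* G) :* X :- q :* ((1′ :- a :* a) :* F) :* X) refl
             q a x X F G ⟩
      x * ((1ℂ - q * a * (q * a)) * G) * X - q * ((1ℂ - a * a) * F) * X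
        ≈⟨ +-cong (*-congʳ (*-congˡ common-m+2)) (-‿cong (*-congʳ (*-congˡ common-m+1))) ⟩
      x * C * X - q * C * X
        ≈⟨ solve 4 (λ x q C X → x :* C :* X :- q :* C :* X := (x :- q) :* C :* X) refl x q C X ⟩
      (x - q) * C * X ∎
      where
      S₂ = ∑< (3 ℕ.+ m) (term x (2 ℕ.+ m))
      S₁ = ∑< (2 ℕ.+ m) (term x (suc m))
      S₀ = ∑< (suc m) (term x m)
      T = term x (suc m) (2 ℕ.+ m)
      V = term x m (suc m)
      W = term x m (2 ℕ.+ m)
      X = x ^ suc m
      F = common m (suc m)
      G = common m (2 ℕ.+ m)

      telescoped : combination S₂ S₁ (S₁ + T) (S₀ + V + W) ≋ 0ℂ
      telescoped = trans
        (combination-cong refl refl (sym (∑<-suc (2 ℕ.+ m) (term x (suc m))))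
          (sym (trans (∑<-suc (2 ℕ.+ m) (term x m)) (+-congʳ (∑<-suc (suc m) (term x m))))))
        -- At this cutoff both U_{m+2} and the shifted U_{m+1} are complete, so they need no
        -- correction.
        (partialSums (2 ℕ.+ m))

      q^[2m+3] : q ^ (2 ℕ.* m ℕ.+ 3) ≋ q * (a * a)
      q^[2m+3] = begin
        q ^ (2 ℕ.* m ℕ.+ 3)        ≡⟨ ≡.cong (q ^_) (exponent m) ⟩
        q ^ suc (suc m ℕ.+ suc m)  ≈⟨ *-congˡ (^-homo-* q (suc m) (suc m)) ⟩
        q * (a * a)                ∎
        where
        exponent : ∀ m → 2 ℕ.* m ℕ.+ 3 ≡ suc (suc m ℕ.+ suc m)
        exponent = ℕS.solve 1 (λ m → ℕS.con 2 ℕS.:* m ℕS.:+ ℕS.con 3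
          ℕS.:= ℕS.con 1 ℕS.:+ ((ℕS.con 1 ℕS.:+ m) ℕS.:+ (ℕS.con 1 ℕS.:+ m))) ≡.refl

theorem3p4 : (q : ℂ) (∣q∣<1 : ∣ q ∣ <ᴿ 1ᴿ) (m : ℕ) (x : ℂ) →
    (1ℂ - q ^ (m ℕ.+ 2)) * U q ∣q∣<1 (m ℕ.+ 2) x
    + (x * q ^ (2 ℕ.* m ℕ.+ 3) - q - 1ℂ) * U q ∣q∣<1 (m ℕ.+ 1) x
    + q * (1ℂ + q ^ (m ℕ.+ 1)) * U q ∣q∣<1 m x
    ≈ (x - q)
    * (poch (q ^ (m ℕ.+ 2)) q m / poch (q ^ 2) (q ^ 2) m [ q²q²-nonZero q ∣q∣<1 m ])
    * x ^ (m ℕ.+ 1)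
theorem3p4 q ∣q∣<1 m x = unwrap (≡.subst₂
  (λ m+2 m+1 →
    (1ℂ - q ^ m+2) * U q ∣q∣<1 m+2 x
      + (x * q ^ (2 ℕ.* m ℕ.+ 3) - q - 1ℂ) * U q ∣q∣<1 m+1 x
      + q * (1ℂ + q ^ m+1) * U q ∣q∣<1 m x
    ≋ (x - q) * (poch (q ^ m+2) q m / poch (q ^ 2) (q ^ 2) m [ q²q²-nonZero q ∣q∣<1 m ]) * x ^ m+1)
  -- The recurrence is proved with the numeral first, where powers and sums unfold. `C` unfolds to
  -- the quotient in the statement.
  (ℕ.+-comm 2 m) (ℕ.+-comm 1 m) (recurrence q ∣q∣<1 m x))
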